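{- One has $259\le f(3,7)\le474$.
   Context: $f(w,k)$ denotes the maximum size of a finite family of distinct $w$-element sets (on an arbitrary finite ground set) containing no $k$-sunflower. A $k$-sunflower is a collection of $k$ distinct sets $A_1,\dots,A_k$ for which there is a set $C$ (the core, possibly empty) with $A_i\cap A_j=C$ for all $i\ne j$. -}

module Defs where

open import Data.Fin using (Fin)
open import Data.Fin.Subset using (Subset; _∩_; ∣_∣)
open import Data.List using (List; length)
open import Data.List.Membership.Propositional using (_∈_)
open import Data.List.Relation.Unary.All using (All)
open import Data.List.Relation.Unary.Unique.Propositional using (Unique)
open import Data.Nat using (ℕ; _≤_)
open import Data.Product using (∃-syntax; _×_)
open import Function.Definitions using (Injective)
open import Relation.Binary.PropositionalEquality using (_≡_; _≢_)
open import Relation.Nullary using (¬_)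

record IsSunflower {n k : ℕ} (A : Fin k → Subset n) : Set where
  field
    distinct : Injective _≡_ _≡_ A
    core     : Subset n
    meet     : ∀ {i j} → i ≢ j → A i ∩ A j ≡ core

ContainsSunflower : {n : ℕ} → ℕ → List (Subset n) → Set
ContainsSunflower {n} k F =
  ∃[ A ] IsSunflower {n} {k} A × (∀ i → A i ∈ F)

-- A finite family of distinct w-element sets without a k-sunflower.  The
-- family is a duplicate-free list, so its size is the length of the list.
record SunflowerFree (w k : ℕ) {n : ℕ} (F : List (Subset n)) : Set where
  field
    unique      : Unique F
    uniform     : All (λ A → ∣ A ∣ ≡ w) F
    noSunflower : ¬ ContainsSunflower k F

-- The graph of the function f: `Isf w k m` says that f(w,k) exists and
-- equals m.  The ground set Fin n is allowed to vary with the family.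
record Isf (w k m : ℕ) : Set where
  field
    attained : ∃[ n ] ∃[ F ] SunflowerFree w k {n} F × length F ≡ m
    bound    : ∀ {n} (F : List (Subset n)) → SunflowerFree w k F → length F ≤ m

{-# OPTIONS --safe #-}
module Submission where

-- Upper bound.  Let M be a maximum set of pairwise disjoint members, so |M| ≤ 6,
-- and V its union.  Every A ∈ F meets V, so |A ∩ V| + [|A ∩ V| = 1] ≥ 2 + [A ∈ M],
-- and summing gives 2|F| + |M| ≤ ∑_{x ∈ V} (deg x + L x), where L x counts the
-- members meeting V only in x.  The link of x is a graph of maximum degree and
-- matching number at most 6, hence deg x ≤ 42; its part outside V has matching
-- number at most 5, as the member of M through x supplies one further disjoint
-- edge, hence L x ≤ 33.  For two points of one member of M the outer links are
-- cross-intersecting, since M is maximum, so L sums to at most 33 over a member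
-- of M, and 2|F| + |M| ≤ (3 · 42 + 33)|M|.  The two graph bounds follow by
-- deleting vertices covered by all maximum matchings and applying Gallai's lemma
-- to what remains.
--
-- Lower bound.  A cyclic family of 260 triples on 20 points in which every point
-- has 13 neighbours and every pair lies in at most 6 triples: a 7-sunflower with
-- a core of size 0, 1, 2 would need 21 points, 14 neighbours, 7 triples.

open import Data.Bool using () renaming (_≟_ to _≟ᵇ_)
open import Data.Empty using (⊥)
open import Data.Fin using (Fin; zero; suc; toℕ; fromℕ<; inject≤)
open import Data.Fin.Properties using (any?; all?; ¬∀⟶∃¬; inject≤-injective; toℕ-fromℕ<) renaming (_≟_ to _≟ᶠ_)
open import Data.Fin.Subset using (Subset; ∣_∣; inside; outside; _∪_; _∩_; ⁅_⁆) renaming (⊥ to ∅; _∈_ to _∈ˢ_; _∉_ to _∉ˢ_)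
open import Data.Fin.Subset.Properties using (_∈?_; drop-there; x∈⁅x⁆; x∈⁅y⁆⇒x≡y; x∈p∪q⁺; x∈p∪q⁻; x∈p∩q⁺; x∈p∩q⁻; ⊆-antisym; ∉⊥; anySubset?)
open import Data.List using (List; []; _∷_; length; filter; allFin; map; upTo; cartesianProductWith)
import Data.List as List
open import Data.List.Membership.Propositional using (_∈_; find; lose)
open import Data.List.Membership.Propositional.Properties using (∈-allFin; ∈-filter⁺; ∈-filter⁻; ∈-lookup; ∈-map⁺; ∈-map⁻)
open import Data.List.Properties using (map-tabulate; length-map; length-tabulate; map-∘; map-id-local)
open import Data.List.Relation.Unary.All using (All; []; _∷_)
import Data.List.Relation.Unary.All as All
open import Data.List.Relation.Unary.All.Properties using (¬Any⇒All¬) renaming (map⁻ to All-map⁻)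
open import Data.List.Relation.Unary.AllPairs using (AllPairs; []; _∷_)
open import Data.List.Relation.Unary.Any using (Any; here; there) renaming (any? to anyᴸ?)
import Data.List.Relation.Unary.Any as Any
open import Data.List.Relation.Unary.Unique.DecPropositional using (unique?)
open import Data.List.Relation.Unary.Unique.Propositional using (Unique)
open import Data.List.Relation.Unary.Unique.Propositional.Properties using (allFin⁺; filter⁺) renaming (map⁺ to Unique-map⁺; map⁻ to Unique-map⁻)
open import Data.Nat using (ℕ; zero; suc; _+_; _*_; _≤_; _<_; z≤n; s≤s; s≤s⁻¹; _≤?_; _<?_; _≟_)
open import Data.Nat.DivMod using (_mod_)
open import Data.Nat.Properties hiding (_≤?_; _<?_; _≟_)
open import Data.Nat.Tactic.RingSolver using (solve-∀)
open import Algebra.Properties.CommutativeSemigroup +-commutativeSemigroup using (interchange)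
open import Data.Product using (_×_; _,_; proj₁; proj₂; ∃; ∃-syntax)
open import Data.Sum using (_⊎_; inj₁; inj₂)
open import Data.Unit using (tt)
open import Data.Vec using (Vec; []; _∷_; here; there; lookup; insertAt; removeAt; toList; fromList) renaming (tabulate to tabulateᵛ)
open import Data.Vec.Properties using (≡-dec; lookup∘tabulate; removeAt-insertAt; insertAt-removeAt; lookup⇒[]=; toList∘fromList; length-toList)
open import Function using (_∘_; id; case_of_)
open import Relation.Binary.Definitions using (DecidableEquality; Symmetric) renaming (Decidable to Decidable₂)
open import Relation.Binary.PropositionalEquality using (_≡_; _≢_; refl; sym; trans; cong; cong₂; subst; ≢-sym; _≗_)
open import Relation.Nullary using (¬_; Dec; yes; no; contradiction)
open import Relation.Nullary.Decidable using (¬?; _×-dec_; _⊎-dec_; _→-dec_; map′; decidable-stable; toWitness)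
open import Relation.Unary using (Decidable)
open import Defs

-- The constants 42 and 33 are 3(2k + b) with b = ⌊2k / 6⌋ for matching numbers k = 6 and k = 5: a
-- degree sum of at most 6(2k + b), halved. The summand [A ∈ M] decides the final value: 159 is odd,
-- and halving 159 · 6 directly gives only 477, while 2|F| ≤ 158|M| gives 79 · 6 = 474. That L sums
-- to 33 over a member of M needs two degrees of cross-intersection. One nonempty outer link caps
-- the other two at 12, which leaves 36 when all three are nonempty; two edges in one link cap the
-- others at 8, and this closes the gap. The theorem also asserts that f(3,7) exists as a number.
-- Constructively this calls for decidable notions throughout, so cardinalities are sums of
-- indicators of decisions, and the maximum is found by a finite search.

private variable
  X Y : Set

-- Double counting with sums of indicators.

𝟙 : {P : Set} → Dec P → ℕ
𝟙 (yes _) = 1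
𝟙 (no  _) = 0

𝟙-yes : {P : Set} (d : Dec P) → P → 𝟙 d ≡ 1
𝟙-yes (yes _) _ = refl
𝟙-yes (no ¬p) p = contradiction p ¬p

𝟙-no : {P : Set} (d : Dec P) → ¬ P → 𝟙 d ≡ 0
𝟙-no (yes p) ¬p = contradiction p ¬p
𝟙-no (no _)  _  = refl

𝟙≤1 : {P : Set} (d : Dec P) → 𝟙 d ≤ 1
𝟙≤1 (yes _) = ≤-refl
𝟙≤1 (no _)  = z≤n

𝟙-mono : {P Q : Set} (d : Dec P) (e : Dec Q) → (P → Q) → 𝟙 d ≤ 𝟙 e
𝟙-mono (yes p) e P→Q = ≤-reflexive (sym (𝟙-yes e (P→Q p)))
𝟙-mono (no _)  e P→Q = z≤n

𝟙-≤ : {P : Set} (d : Dec P) {m : ℕ} → (P → 1 ≤ m) → 𝟙 d ≤ m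
𝟙-≤ (yes p) h = h p
𝟙-≤ (no _)  h = z≤n

∑ : List X → (X → ℕ) → ℕ
∑ []       f = 0
∑ (x ∷ xs) f = f x + ∑ xs f

syntax ∑ xs (λ x → e) = ∑[ x ∈ xs ] e

∑-mono : {f g : X → ℕ} (xs : List X) → (∀ {x} → x ∈ xs → f x ≤ g x) → ∑ xs f ≤ ∑ xs g
∑-mono []       h = z≤n
∑-mono (x ∷ xs) h = +-mono-≤ (h (here refl)) (∑-mono xs (h ∘ there))

∑-cong : {f g : X → ℕ} (xs : List X) → (∀ x → f x ≡ g x) → ∑ xs f ≡ ∑ xs g
∑-cong []       h = refl
∑-cong (x ∷ xs) h = cong₂ _+_ (h x) (∑-cong xs h)

∑-distrib-+ : (xs : List X) (f g : X → ℕ) → ∑[ x ∈ xs ] (f x + g x) ≡ ∑ xs f + ∑ xs g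
∑-distrib-+ []       f g = refl
∑-distrib-+ (x ∷ xs) f g =
  trans (cong (f x + g x +_) (∑-distrib-+ xs f g)) (interchange (f x) (g x) _ _)

∑-distribʳ-* : (xs : List X) (f : X → ℕ) (c : ℕ) → ∑[ x ∈ xs ] (f x * c) ≡ ∑ xs f * c
∑-distribʳ-* []       f c = refl
∑-distribʳ-* (x ∷ xs) f c =
  trans (cong (f x * c +_) (∑-distribʳ-* xs f c)) (sym (*-distribʳ-+ c (f x) _))

∑-const : (xs : List X) (c : ℕ) → ∑[ _ ∈ xs ] c ≡ length xs * c
∑-const []       c = refl
∑-const (x ∷ xs) c = cong (c +_) (∑-const xs c)

∑-swap : (xs : List X) (ys : List Y) (f : X → Y → ℕ) →
         ∑[ x ∈ xs ] ∑[ y ∈ ys ] f x y ≡ ∑[ y ∈ ys ] ∑[ x ∈ xs ] f x y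
∑-swap []       ys f = sym (trans (∑-const ys 0) (*-zeroʳ (length ys)))
∑-swap (x ∷ xs) ys f =
  trans (cong (∑ ys (f x) +_) (∑-swap xs ys f)) (sym (∑-distrib-+ ys (f x) _))

∑-∈ : {xs : List X} (f : X → ℕ) {x : X} → x ∈ xs → f x ≤ ∑ xs f
∑-∈ f (here refl)      = m≤m+n _ _
∑-∈ f (there {x = y} i) = ≤-trans (∑-∈ f i) (m≤n+m _ (f y))

∑-≡0 : {f : X → ℕ} (xs : List X) → (∀ {x} → x ∈ xs → f x ≡ 0) → ∑ xs f ≡ 0
∑-≡0 []       h = refl
∑-≡0 (x ∷ xs) h = cong₂ _+_ (h (here refl)) (∑-≡0 xs (h ∘ there))

module _ {P : X → Set} (P? : Decidable P) where

  length-filter : ∀ xs → length (filter P? xs) ≡ ∑[ x ∈ xs ] 𝟙 (P? x)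
  length-filter [] = refl
  length-filter (x ∷ xs) with P? x
  ... | yes _ = cong suc (length-filter xs)
  ... | no _  = length-filter xs

  -- The inner bound of most double counts below: after a swap of sums, each object on the other
  -- side is hit at most once, and only when it satisfies `Q`.
  ∑-𝟙-unique : {Q : Set} (Q? : Dec Q) {xs : List X} → Unique xs →
               (∀ {x} → x ∈ xs → P x → Q) →
               (∀ {x y} → x ∈ xs → y ∈ xs → P x → P y → x ≡ y) →
               ∑[ x ∈ xs ] 𝟙 (P? x) ≤ 𝟙 Q?
  ∑-𝟙-unique Q? {[]} _ _ _ = z≤n
  ∑-𝟙-unique Q? {x ∷ xs} (x∉ ∷ uniq) P⇒Q inj with P? x
  ... | yes Px = ≤-reflexive (trans (cong suc rest≡0) (sym (𝟙-yes Q? (P⇒Q (here refl) Px))))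
    where
    rest≡0 : ∑[ y ∈ xs ] 𝟙 (P? y) ≡ 0
    rest≡0 = ∑-≡0 xs λ {y} y∈ → 𝟙-no (P? y) λ Py →
      All.lookup x∉ y∈ (inj (here refl) (there y∈) Px Py)
  ... | no ¬Px = ∑-𝟙-unique Q? uniq (P⇒Q ∘ there) (λ i j → inj (there i) (there j))

  ∑-𝟙≤1 : {xs : List X} → Unique xs →
          (∀ {x y} → x ∈ xs → y ∈ xs → P x → P y → x ≡ y) → ∑[ x ∈ xs ] 𝟙 (P? x) ≤ 1
  ∑-𝟙≤1 uniq inj = ∑-𝟙-unique (yes refl) uniq (λ _ _ → refl {x = 0}) inj

module _ (_≟_ : DecidableEquality X) where

  δ-∑ : {xs : List X} {x : X} → Unique xs → x ∈ xs → ∑[ y ∈ xs ] 𝟙 (x ≟ y) ≡ 1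
  δ-∑ {xs} {x} uniq x∈ = ≤-antisym
    (∑-𝟙≤1 (x ≟_) uniq (λ _ _ x≡y x≡z → trans (sym x≡y) x≡z))
    (≤-trans (≤-reflexive (sym (𝟙-yes (x ≟ x) refl))) (∑-∈ (λ y → 𝟙 (x ≟ y)) x∈))

  -- Counts the pairs (x , y) with x ≡ y in both orders: each x has at least one partner in `ys`,
  -- each y at most one in the duplicate-free `xs`.
  length-⊆ : {xs ys : List X} → Unique xs → (∀ {x} → x ∈ xs → x ∈ ys) → length xs ≤ length ys
  length-⊆ {xs} {ys} uniq xs⊆ys = begin
    length xs                                  ≡⟨ trans (sym (*-identityʳ _)) (sym (∑-const xs 1)) ⟩
    ∑[ x ∈ xs ] 1                              ≤⟨ ∑-mono xs (λ {x} x∈ → ≤-trans (≤-reflexive (sym (𝟙-yes (x ≟ x) refl)))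
                                                                          (∑-∈ (λ y → 𝟙 (x ≟ y)) (xs⊆ys x∈))) ⟩
    ∑[ x ∈ xs ] ∑[ y ∈ ys ] 𝟙 (x ≟ y)          ≡⟨ ∑-swap xs ys _ ⟩
    ∑[ y ∈ ys ] ∑[ x ∈ xs ] 𝟙 (x ≟ y)          ≤⟨ ∑-mono ys (λ {y} _ → ∑-𝟙≤1 (_≟ y) uniq (λ _ _ x≡y z≡y → trans x≡y (sym z≡y))) ⟩
    ∑[ y ∈ ys ] 1                              ≡⟨ trans (∑-const ys 1) (*-identityʳ _) ⟩
    length ys                                  ∎
    where open ≤-Reasoning

δᶠ : {n : ℕ} (x : Fin n) → ∑[ y ∈ allFin n ] 𝟙 (x ≟ᶠ y) ≡ 1
δᶠ {n} x = δ-∑ _≟ᶠ_ (allFin⁺ n) (∈-allFin x)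

∑-map : (f : Y → ℕ) (g : X → Y) (xs : List X) → ∑ (map g xs) f ≡ ∑ xs (f ∘ g)
∑-map f g []       = refl
∑-map f g (x ∷ xs) = cong (f (g x) +_) (∑-map f g xs)

∑-allFin-suc : ∀ {n} (f : Fin (suc n) → ℕ) → ∑ (allFin (suc n)) f ≡ f zero + ∑ (allFin n) (f ∘ suc)
∑-allFin-suc {n} f = cong (f zero +_)
  (trans (cong (λ ys → ∑ ys f) (sym (map-tabulate (λ i → i) suc))) (∑-map f suc (allFin n)))

∣∣≡∑ : ∀ {n} (s : Subset n) → ∣ s ∣ ≡ ∑[ x ∈ allFin n ] 𝟙 (x ∈? s)
∣∣≡∑ [] = refl
∣∣≡∑ {suc n} (inside ∷ s) = trans
  (cong suc (trans (∣∣≡∑ s) (∑-cong (allFin n) λ x →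
    ≤-antisym (𝟙-mono (x ∈? s) (suc x ∈? (inside ∷ s)) there)
              (𝟙-mono (suc x ∈? (inside ∷ s)) (x ∈? s) drop-there))))
  (sym (∑-allFin-suc λ x → 𝟙 (x ∈? (inside ∷ s))))
∣∣≡∑ {suc n} (outside ∷ s) = trans
  (trans (∣∣≡∑ s) (∑-cong (allFin n) λ x →
    ≤-antisym (𝟙-mono (x ∈? s) (suc x ∈? (outside ∷ s)) there)
              (𝟙-mono (suc x ∈? (outside ∷ s)) (x ∈? s) drop-there)))
  (sym (∑-allFin-suc λ x → 𝟙 (x ∈? (outside ∷ s))))

-- Finite search over tables of values.

Searchable : Set → Set₁
Searchable A = {P : A → Set} → Decidable P → Dec (∃ P)

searchVec : {A : Set} → Searchable A → ∀ m → Searchable (Vec A m)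
searchVec any zero    P? = map′ ([] ,_) (λ { ([] , p) → p }) (P? [])
searchVec any (suc m) P? =
  map′ (λ { (x , xs , p) → x ∷ xs , p }) (λ { (x ∷ xs , p) → x , xs , p })
       (any λ x → searchVec any m λ xs → P? (x ∷ xs))

-- Matchings as involutions.

-- A matching is encoded by the involution exchanging the two ends of each of
-- its edges and fixing the vertices it misses.
Mate : ℕ → Set
Mate n = Fin n → Fin n

module _ {n : ℕ} where

  record IsMatching (E : Fin n → Fin n → Set) (M : Mate n) : Set where
    field
      involutive : ∀ x → M (M x) ≡ x
      edge       : ∀ {x} → M x ≢ x → E x (M x)

  covered : Mate n → ℕ
  covered M = ∑[ x ∈ allFin n ] 𝟙 (¬? (M x ≟ᶠ x))

  remove : Mate n → Fin n → Mate n
  remove M x t with t ≟ᶠ x | t ≟ᶠ M x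
  ... | yes _ | _     = t
  ... | no _  | yes _ = t
  ... | no _  | no _  = M t

  remove-fst : ∀ M {x} → remove M x x ≡ x
  remove-fst M {x} with x ≟ᶠ x | x ≟ᶠ M x
  ... | yes _ | _     = refl
  ... | no _  | yes _ = refl
  ... | no x≢x | no _ = contradiction refl x≢x

  remove-snd : ∀ M {x} → remove M x (M x) ≡ M x
  remove-snd M {x} with M x ≟ᶠ x | M x ≟ᶠ M x
  ... | yes _ | _     = refl
  ... | no _  | yes _ = refl
  ... | no _ | no y≢y = contradiction refl y≢y

  remove-other : ∀ M {x t} → t ≢ x → t ≢ M x → remove M x t ≡ M t
  remove-other M {x} {t} t≢x t≢y with t ≟ᶠ x | t ≟ᶠ M x
  ... | yes t≡x | _     = contradiction t≡x t≢x
  ... | no _  | yes t≡y = contradiction t≡y t≢y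
  ... | no _ | no _ = refl

  remove-fixes : ∀ M {x t} → M t ≡ t → remove M x t ≡ t
  remove-fixes M {x} {t} Mt≡t with t ≟ᶠ x | t ≟ᶠ M x
  ... | yes t≡x | _     = refl
  ... | no _  | yes t≡y = refl
  ... | no _ | no _ = Mt≡t

  remove-moves : ∀ M {x t} → remove M x t ≢ t → t ≢ x × t ≢ M x × remove M x t ≡ M t
  remove-moves M {x} {t} ≢t with t ≟ᶠ x | t ≟ᶠ M x
  ... | yes t≡x | _     = contradiction refl ≢t
  ... | no _  | yes t≡y = contradiction refl ≢t
  ... | no t≢x | no t≢y = t≢x , t≢y , refl

  add : Mate n → Fin n → Fin n → Mate n
  add M x y t with t ≟ᶠ x | t ≟ᶠ y
  ... | yes _ | _     = y
  ... | no _  | yes _ = x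
  ... | no _  | no _  = M t

  add-fst : ∀ M x y → add M x y x ≡ y
  add-fst M x y with x ≟ᶠ x
  ... | yes _ = refl
  ... | no x≢x = contradiction refl x≢x

  add-snd : ∀ M x y → add M x y y ≡ x
  add-snd M x y with y ≟ᶠ x | y ≟ᶠ y
  ... | yes y≡x | _     = y≡x
  ... | no _ | yes _  = refl
  ... | no _ | no y≢y = contradiction refl y≢y

  add-other : ∀ M {x y t} → t ≢ x → t ≢ y → add M x y t ≡ M t
  add-other M {x} {y} {t} t≢x t≢y with t ≟ᶠ x | t ≟ᶠ y
  ... | yes t≡x | _     = contradiction t≡x t≢x
  ... | no _  | yes t≡y = contradiction t≡y t≢y
  ... | no _ | no _ = refl

  module _ {E : Fin n → Fin n → Set} {M : Mate n} (isM : IsMatching E M) where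
    open IsMatching isM

    M-injective : ∀ {x y} → M x ≡ M y → x ≡ y
    M-injective {x} {y} eq = trans (sym (involutive x)) (trans (cong M eq) (involutive y))

    M-swap : ∀ {x y} → M x ≡ y → M y ≡ x
    M-swap {x} refl = involutive x

    remove-isMatching : ∀ x → IsMatching E (remove M x)
    remove-isMatching x = record { involutive = inv ; edge = edg }
      where
      inv : ∀ t → remove M x (remove M x t) ≡ t
      inv t with t ≟ᶠ x | t ≟ᶠ M x
      ... | yes refl | _     = remove-fst M
      ... | no _  | yes refl = remove-snd M
      ... | no t≢x | no t≢y = trans
        (remove-other M (λ Mt≡x → t≢y (sym (M-swap Mt≡x))) (t≢x ∘ M-injective))
        (involutive t)
      edg : ∀ {t} → remove M x t ≢ t → E t (remove M x t)
      edg {t} ≢t with remove-moves M ≢t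
      ... | _ , _ , eq = subst (E t) (sym eq) (edge (λ Mt≡t → ≢t (trans eq Mt≡t)))

    covered-remove : ∀ {x} → M x ≢ x → covered (remove M x) + 2 ≡ covered M
    covered-remove {x} Mx≢x =
      trans (cong₂ _+_ refl (sym (cong₂ _+_ (δᶠ x) (δᶠ (M x)))))
      (trans (cong (covered (remove M x) +_) (sym (∑-distrib-+ (allFin n) _ _)))
      (trans (sym (∑-distrib-+ (allFin n) _ _)) (∑-cong (allFin n) pointwise)))
      where
      pointwise : ∀ t → 𝟙 (¬? (remove M x t ≟ᶠ t)) + (𝟙 (x ≟ᶠ t) + 𝟙 (M x ≟ᶠ t)) ≡ 𝟙 (¬? (M t ≟ᶠ t))
      pointwise t = cases t (t ≟ᶠ x) (t ≟ᶠ M x)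
        where
        cases : ∀ t → Dec (t ≡ x) → Dec (t ≡ M x) →
                𝟙 (¬? (remove M x t ≟ᶠ t)) + (𝟙 (x ≟ᶠ t) + 𝟙 (M x ≟ᶠ t)) ≡ 𝟙 (¬? (M t ≟ᶠ t))
        cases t (yes refl) _ = trans
          (cong₂ _+_ (𝟙-no (¬? (remove M x x ≟ᶠ x)) (λ ¬e → ¬e (remove-fst M)))
                     (cong₂ _+_ (𝟙-yes (x ≟ᶠ x) refl) (𝟙-no (M x ≟ᶠ x) Mx≢x)))
          (sym (𝟙-yes (¬? (M x ≟ᶠ x)) Mx≢x))
        cases t (no t≢x) (yes refl) = trans
          (cong₂ _+_ (𝟙-no (¬? (remove M x t ≟ᶠ t)) (λ ¬e → ¬e (remove-snd M)))
                     (cong₂ _+_ (𝟙-no (x ≟ᶠ t) (≢-sym t≢x)) (𝟙-yes (t ≟ᶠ t) refl)))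
          (sym (𝟙-yes (¬? (M t ≟ᶠ t)) (λ e → Mx≢x (M-injective e))))
        cases t (no t≢x) (no t≢y) = trans
          (cong₂ _+_ (cong (λ s → 𝟙 (¬? (s ≟ᶠ t))) (remove-other M t≢x t≢y))
                     (cong₂ _+_ (𝟙-no (x ≟ᶠ t) (≢-sym t≢x)) (𝟙-no (M x ≟ᶠ t) (≢-sym t≢y))))
          (+-identityʳ _)

    module _ (E-sym : Symmetric E) {x y : Fin n} (Mx≡x : M x ≡ x) (My≡y : M y ≡ y)
             (x≢y : x ≢ y) (Exy : E x y) where

      private
        avoid : ∀ {t z} → M z ≡ z → t ≢ z → M t ≢ z
        avoid Mz≡z t≢z Mt≡z = t≢z (M-injective (trans Mt≡z (sym Mz≡z)))

      add-isMatching : IsMatching E (add M x y)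
      add-isMatching = record { involutive = inv ; edge = edg }
        where
        inv : ∀ t → add M x y (add M x y t) ≡ t
        inv t = cases (t ≟ᶠ x) (t ≟ᶠ y)
          where
          cases : Dec (t ≡ x) → Dec (t ≡ y) → add M x y (add M x y t) ≡ t
          cases (yes refl) _ = trans (cong (add M x y) (add-fst M x y)) (add-snd M x y)
          cases (no _) (yes refl) = trans (cong (add M x y) (add-snd M x y)) (add-fst M x y)
          cases (no t≢x) (no t≢y) = trans (cong (add M x y) (add-other M t≢x t≢y))
            (trans (add-other M (avoid Mx≡x t≢x) (avoid My≡y t≢y)) (involutive t))
        edg : ∀ {t} → add M x y t ≢ t → E t (add M x y t)
        edg {t} ≢t with t ≟ᶠ x | t ≟ᶠ y
        ... | yes refl | _     = Exy
        ... | no _  | yes refl = E-sym Exy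
        ... | no t≢x | no t≢y = edge ≢t

      covered-add : covered (add M x y) ≡ covered M + 2
      covered-add = sym
        (trans (cong₂ _+_ refl (sym (cong₂ _+_ (δᶠ x) (δᶠ y))))
        (trans (cong (covered M +_) (sym (∑-distrib-+ (allFin n) _ _)))
        (trans (sym (∑-distrib-+ (allFin n) _ _)) (∑-cong (allFin n) pointwise))))
        where
        pointwise : ∀ t → 𝟙 (¬? (M t ≟ᶠ t)) + (𝟙 (x ≟ᶠ t) + 𝟙 (y ≟ᶠ t)) ≡ 𝟙 (¬? (add M x y t ≟ᶠ t))
        pointwise t = cases t (t ≟ᶠ x) (t ≟ᶠ y)
          where
          cases : ∀ t → Dec (t ≡ x) → Dec (t ≡ y) →
                  𝟙 (¬? (M t ≟ᶠ t)) + (𝟙 (x ≟ᶠ t) + 𝟙 (y ≟ᶠ t)) ≡ 𝟙 (¬? (add M x y t ≟ᶠ t))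
          cases t (yes refl) _ = trans
            (cong₂ _+_ (𝟙-no (¬? (M x ≟ᶠ x)) (λ ¬e → ¬e Mx≡x))
                       (cong₂ _+_ (𝟙-yes (x ≟ᶠ x) refl) (𝟙-no (y ≟ᶠ x) (≢-sym x≢y))))
            (sym (𝟙-yes (¬? (add M x y x ≟ᶠ x)) (λ e → x≢y (sym (trans (sym (add-fst M x y)) e)))))
          cases t (no t≢x) (yes refl) = trans
            (cong₂ _+_ (𝟙-no (¬? (M t ≟ᶠ t)) (λ ¬e → ¬e My≡y))
                       (cong₂ _+_ (𝟙-no (x ≟ᶠ t) x≢y) (𝟙-yes (t ≟ᶠ t) refl)))
            (sym (𝟙-yes (¬? (add M x t t ≟ᶠ t)) (λ e → x≢y (trans (sym (add-snd M x t)) e))))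
          cases t (no t≢x) (no t≢y) = trans
            (cong₂ _+_ (cong (λ s → 𝟙 (¬? (s ≟ᶠ t))) (sym (add-other M t≢x t≢y)))
                       (cong₂ _+_ (𝟙-no (x ≟ᶠ t) (≢-sym t≢x)) (𝟙-no (y ≟ᶠ t) (≢-sym t≢y))))
            (+-identityʳ _)

  Avoids : Fin n × Fin n → Fin n → Set
  Avoids (x , y) z = x ≢ z × y ≢ z

  DisjointPairs : Fin n × Fin n → Fin n × Fin n → Set
  DisjointPairs p (x , y) = Avoids p x × Avoids p y

  -- The recursion is on the bound `f`, since removing an edge does not make the mate structurally
  -- smaller. The clauses `M x ≢ x` in the result serve the induction: a point still moved after the
  -- removal differs from both removed ends.
  edgeList : ∀ {E} f M → IsMatching E M → covered M ≤ f →
             ∃[ ps ] covered M ≡ 2 * length ps × All (λ (x , y) → E x y × M x ≢ x × M y ≢ y) ps ×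
                     AllPairs DisjointPairs ps
  edgeList f M isM ≤f with any? (λ x → ¬? (M x ≟ᶠ x))
  edgeList f M isM ≤f | no none =
    [] , ∑-≡0 (allFin n) (λ {x} _ → 𝟙-no (¬? (M x ≟ᶠ x)) (λ Mx≢x → none (x , Mx≢x))) , [] , []
  edgeList zero M isM ≤f | yes (x , Mx≢x) =
    contradiction (≤-trans (≤-reflexive (covered-remove isM Mx≢x)) ≤f)
                  (λ h → <⇒≱ (≤-trans (s≤s z≤n) (m≤n+m 2 (covered (remove M x)))) h)
  edgeList {E} (suc f) M isM ≤f | yes (x , Mx≢x) =
    let ps , len , good , disj = edgeList f (remove M x) (remove-isMatching isM x) smaller
    in (x , M x) ∷ ps
     , trans (sym (covered-remove isM Mx≢x)) (trans (cong (_+ 2) len) (double (length ps)))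
     , (edge Mx≢x , Mx≢x , (λ eq → Mx≢x (M-injective isM eq)))
       ∷ All.map (λ (e , u , v) → e , keep u , keep v) good
     , All.map (λ (_ , u , v) → apart u , apart v) good ∷ disj
    where
    open IsMatching isM
    double : ∀ l → 2 * l + 2 ≡ 2 * suc l
    double = solve-∀
    smaller : covered (remove M x) ≤ f
    smaller = s≤s⁻¹ (≤-trans (≤-trans (≤-reflexive (+-comm 1 _)) (+-monoʳ-≤ (covered (remove M x)) (s≤s z≤n)))
                          (≤-trans (≤-reflexive (covered-remove isM Mx≢x)) ≤f))
    keep : ∀ {t} → remove M x t ≢ t → M t ≢ t
    keep ≢t Mt≡t = ≢t (remove-fixes M Mt≡t)
    apart : ∀ {t} → remove M x t ≢ t → x ≢ t × M x ≢ t
    apart ≢t = let t≢x , t≢y , _ = remove-moves M ≢t in ≢-sym t≢x , ≢-sym t≢y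

module _ {n : ℕ} {E : Fin n → Fin n → Set} where

  covered-cong : ∀ {M N : Mate n} → M ≗ N → covered M ≡ covered N
  covered-cong eq = ∑-cong (allFin n) λ x → cong (λ y → 𝟙 (¬? (y ≟ᶠ x))) (eq x)

  IsMatching-cong : ∀ {M N : Mate n} → M ≗ N → IsMatching E M → IsMatching E N
  IsMatching-cong {M} {N} eq isM = record
    { involutive = λ x → trans (sym (trans (eq (M x)) (cong N (eq x)))) (involutive x)
    ; edge       = λ {x} Nx≢x → subst (E x) (eq x) (edge (λ Mx≡x → Nx≢x (trans (sym (eq x)) Mx≡x)))
    }
    where open IsMatching isM

  isMatching? : Decidable₂ E → Decidable (IsMatching E)
  isMatching? E? M =
    map′ (λ (i , e) → record { involutive = i ; edge = λ {x} → e x })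
         (λ m → IsMatching.involutive m , λ x → IsMatching.edge m)
         (all? (λ x → M (M x) ≟ᶠ x) ×-dec all? (λ x → ¬? (M x ≟ᶠ x) →-dec E? x (M x)))

  -- Missing a single vertex is the diagonal case `Misses k v v`. When no matching has more than k
  -- edges, the matchings in question are the maximum ones.
  Misses : ℕ → Fin n → Fin n → Set
  Misses k u v = ∃[ M ] IsMatching E M × 2 * k ≤ covered M × M u ≡ u × M v ≡ v

  -- The search runs over tables of mates. A tabulated mate agrees with the given one pointwise,
  -- which is why matchings are transported along `≗`.
  misses? : Decidable₂ E → ∀ k → Decidable₂ (Misses k)
  misses? E? k u v =
    map′ (λ (Ms , good) → lookup Ms , good)
         (λ (M , isM , big , Mu , Mv) → let eq = sym ∘ lookup∘tabulate M in tabulateᵛ M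
           , IsMatching-cong eq isM
           , ≤-trans big (≤-reflexive (covered-cong eq))
           , trans (sym (eq u)) Mu , trans (sym (eq v)) Mv)
         (searchVec any? n λ Ms → let M = lookup Ms in
           isMatching? E? M ×-dec (2 * k ≤? covered M) ×-dec (M u ≟ᶠ u) ×-dec (M v ≟ᶠ v))

-- Gallai's lemma by exchanging edges.

-- Gallai's lemma: if every vertex is missed by some maximum matching, then
-- "no maximum matching misses both" is a transitive relation on vertices.
module Gallai
  {n : ℕ} {E : Fin n → Fin n → Set} (E? : Decidable₂ E) (E-sym : Symmetric E)
  (E-irrefl : ∀ {x y} → E x y → x ≢ y) (k : ℕ)
  (bounded : ∀ M → IsMatching E M → covered M < 2 * suc k)
  (missed : ∀ v → Misses {E = E} k v v) where

  -- Parity: a matching covers an even number of vertices, so fewer than 2k + 2 means at most 2k.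
  covered-max : ∀ {M} → IsMatching E M → covered M ≤ 2 * k
  covered-max {M} isM =
    let ps , len , _ = edgeList (covered M) M isM ≤-refl
    in ≤-trans (≤-reflexive len)
         (*-monoʳ-≤ 2 {length ps} {k} (s≤s⁻¹ (*-cancelˡ-< 2 (length ps) (suc k) (≤-trans (s≤s (≤-reflexive (sym len))) (bounded M isM)))))

  infix 4 _∼_ _∼?_
  -- The escape clause `x ≢ y` makes the relation reflexive even though every single vertex is
  -- missed by some maximum matching. It becomes an equivalence, and one maximum matching misses at
  -- most one vertex of each class.
  _∼_ : Fin n → Fin n → Set
  x ∼ y = x ≢ y → ¬ Misses {E = E} k x y

  _∼?_ : Decidable₂ _∼_
  x ∼? y = ¬? (x ≟ᶠ y) →-dec ¬? (misses? E? k x y)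

  ∼-sym : ∀ {x y} → x ∼ y → y ∼ x
  ∼-sym x∼y y≢x (M , isM , big , My , Mx) = x∼y (≢-sym y≢x) (M , isM , big , Mx , My)

  ∼-apart : ∀ {x y M} → x ∼ y → IsMatching E M → 2 * k ≤ covered M → M x ≡ x → M y ≡ y → x ≡ y
  ∼-apart {x} {y} x∼y isM big Mx My =
    decidable-stable (x ≟ᶠ y) λ x≢y → x∼y x≢y (_ , isM , big , Mx , My)

  -- An edge between two missed vertices could be added to a maximum matching.
  E⇒∼ : ∀ {x y} → E x y → x ∼ y
  E⇒∼ {x} {y} Exy x≢y (M , isM , big , Mx , My) = <⇒≱ (bounded _ (add-isMatching isM E-sym Mx My x≢y Exy))
    (≤-trans (≤-reflexive (double k)) (≤-trans (+-monoˡ-≤ 2 big)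
      (≤-reflexive (sym (covered-add isM E-sym Mx My x≢y Exy)))))
    where
    double : ∀ l → 2 * suc l ≡ 2 * l + 2
    double = solve-∀

  private
    diff : Mate n → Mate n → ℕ
    diff M N = ∑[ x ∈ allFin n ] 𝟙 (¬? (M x ≟ᶠ N x))

  module _ {u v w : Fin n} (u∼w : u ∼ w) (w∼v : w ∼ v) (u≢v : u ≢ v) (u≢w : u ≢ w) (w≢v : w ≢ v)
           {M : Mate n} (isM : IsMatching E M) (M-big : 2 * k ≤ covered M)
           (Mu : M u ≡ u) (Mv : M v ≡ v) where

    private
      moves : ∀ {x N} → IsMatching E N → 2 * k ≤ covered N → N w ≡ w → x ∼ w → x ≢ w → N x ≢ x
      moves isN N-big Nw x∼w x≢w Nx = x≢w (∼-apart x∼w isN N-big Nx Nw)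

      -- N misses w, hence covers u and v, both missed by M. If N also covered every vertex other
      -- than w that M covers, it would satisfy |M| + 2 ≤ |N| + 1 in covered vertices, although both
      -- matchings are maximum.
      exposed : ∀ {N} → IsMatching E N → 2 * k ≤ covered N → N w ≡ w →
             ∃[ x ] x ≢ w × N x ≡ x × M x ≢ x
      exposed {N} isN N-big Nw with any? (λ x → ¬? (x ≟ᶠ w) ×-dec (N x ≟ᶠ x) ×-dec ¬? (M x ≟ᶠ x))
      ... | yes found = found
      ... | no none = contradiction count
        (<⇒≱ (≤-trans (≤-reflexive (+-comm 2 (2 * k))) (+-monoˡ-≤ 2 M-big)))
        where
        pointwise : ∀ x → Dec (x ≡ u) → Dec (x ≡ v) → Dec (x ≡ w) →
          𝟙 (¬? (M x ≟ᶠ x)) + (𝟙 (u ≟ᶠ x) + 𝟙 (v ≟ᶠ x)) ≤ 𝟙 (¬? (N x ≟ᶠ x)) + 𝟙 (w ≟ᶠ x)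
        pointwise x (yes refl) _ _
          rewrite 𝟙-no (¬? (M x ≟ᶠ x)) (λ ne → ne Mu) | 𝟙-yes (x ≟ᶠ x) refl
                | 𝟙-no (v ≟ᶠ x) (≢-sym u≢v)
                | 𝟙-yes (¬? (N x ≟ᶠ x)) (moves isN N-big Nw u∼w u≢w) = s≤s z≤n
        pointwise x (no _) (yes refl) _
          rewrite 𝟙-no (¬? (M x ≟ᶠ x)) (λ ne → ne Mv) | 𝟙-yes (x ≟ᶠ x) refl
                | 𝟙-no (u ≟ᶠ x) u≢v
                | 𝟙-yes (¬? (N x ≟ᶠ x)) (moves isN N-big Nw (∼-sym w∼v) (≢-sym w≢v)) = s≤s z≤n
        pointwise x (no x≢u) (no x≢v) (yes refl)
          rewrite 𝟙-no (u ≟ᶠ x) (≢-sym x≢u) | 𝟙-no (v ≟ᶠ x) (≢-sym x≢v) | 𝟙-yes (x ≟ᶠ x) refl =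
            ≤-trans (≤-reflexive (+-identityʳ _)) (≤-trans (𝟙≤1 (¬? (M x ≟ᶠ x))) (m≤n+m 1 _))
        pointwise x (no x≢u) (no x≢v) (no x≢w)
          rewrite 𝟙-no (u ≟ᶠ x) (≢-sym x≢u) | 𝟙-no (v ≟ᶠ x) (≢-sym x≢v) =
            +-mono-≤ (𝟙-mono (¬? (M x ≟ᶠ x)) (¬? (N x ≟ᶠ x)) λ Mx Nx → none (x , x≢w , Nx , Mx)) z≤n
        count : covered M + 2 ≤ suc (2 * k)
        count = begin
          covered M + 2
            ≡⟨ cong (covered M +_) (cong₂ _+_ (sym (δᶠ u)) (sym (δᶠ v))) ⟩
          covered M + (∑[ x ∈ allFin n ] 𝟙 (u ≟ᶠ x) + ∑[ x ∈ allFin n ] 𝟙 (v ≟ᶠ x))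
            ≡⟨ cong (covered M +_) (sym (∑-distrib-+ (allFin n) _ _)) ⟩
          covered M + ∑[ x ∈ allFin n ] (𝟙 (u ≟ᶠ x) + 𝟙 (v ≟ᶠ x))
            ≡⟨ sym (∑-distrib-+ (allFin n) _ _) ⟩
          ∑[ x ∈ allFin n ] (𝟙 (¬? (M x ≟ᶠ x)) + (𝟙 (u ≟ᶠ x) + 𝟙 (v ≟ᶠ x)))
            ≤⟨ ∑-mono (allFin n) (λ {x} _ → pointwise x (x ≟ᶠ u) (x ≟ᶠ v) (x ≟ᶠ w)) ⟩
          ∑[ x ∈ allFin n ] (𝟙 (¬? (N x ≟ᶠ x)) + 𝟙 (w ≟ᶠ x))
            ≡⟨ ∑-distrib-+ (allFin n) _ _ ⟩
          covered N + ∑[ x ∈ allFin n ] 𝟙 (w ≟ᶠ x)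
            ≡⟨ cong (covered N +_) (δᶠ w) ⟩
          covered N + 1
            ≤⟨ +-monoˡ-≤ 1 (covered-max isN) ⟩
          2 * k + 1
            ≡⟨ +-comm (2 * k) 1 ⟩
          suc (2 * k) ∎
          where open ≤-Reasoning

    -- Exchanging the edge yz of N for the edge xy of M keeps N maximum and
    -- missing w, and brings it closer to M.
    descent : ∀ d {N} → IsMatching E N → 2 * k ≤ covered N → N w ≡ w → diff M N ≤ d → ⊥
    descent d {N} isN N-big Nw ≤d with exposed isN N-big Nw
    ... | x , x≢w , Nx , Mx≢x with N (M x) ≟ᶠ M x
    -- If N misses the M-partner of x as well, the edge of M between them augments N.
    ...   | yes Ny = E⇒∼ (IsMatching.edge isM Mx≢x) (≢-sym Mx≢x) (N , isN , N-big , Nx , Ny)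
    ...   | no Ny≢y = conclude d ≤d
      where
      y z : Fin n
      y = M x
      z = N y
      My≡x : M y ≡ x
      My≡x = IsMatching.involutive isM x
      Nz≡y : N z ≡ y
      Nz≡y = IsMatching.involutive isN y
      x≢y : x ≢ y
      x≢y = ≢-sym Mx≢x
      x≢z : x ≢ z
      x≢z x≡z = Ny≢y (trans (sym x≡z) (trans (sym Nx) (trans (cong N x≡z) Nz≡y)))
      y≢w : y ≢ w
      y≢w y≡w = Ny≢y (trans (cong N y≡w) (trans Nw (sym y≡w)))
      R N′ : Mate n
      R = remove N y
      N′ = add R x y
      isR : IsMatching E R
      isR = remove-isMatching isN y
      Rx : R x ≡ x
      Rx = remove-fixes N Nx
      Ry : R y ≡ y
      Ry = remove-fst N
      isN′ : IsMatching E N′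
      isN′ = add-isMatching isR E-sym Rx Ry x≢y (IsMatching.edge isM Mx≢x)
      N′-big : 2 * k ≤ covered N′
      N′-big = ≤-trans N-big (≤-reflexive (sym (trans
        (covered-add isR E-sym Rx Ry x≢y (IsMatching.edge isM Mx≢x)) (covered-remove isN Ny≢y))))
      N′w : N′ w ≡ w
      N′w = trans (add-other R (≢-sym x≢w) (≢-sym y≢w)) (remove-fixes N Nw)
      -- The new mate agrees with M at x, where N did not, and also at y. Nothing is lost at z: M
      -- sends y to x ≢ z, so M and N already disagreed there.
      pointwise : ∀ t → Dec (t ≡ x) → Dec (t ≡ y) → Dec (t ≡ z) →
                  𝟙 (¬? (M t ≟ᶠ N′ t)) + 𝟙 (x ≟ᶠ t) ≤ 𝟙 (¬? (M t ≟ᶠ N t))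
      pointwise t (yes refl) _ _
        rewrite 𝟙-no (¬? (M x ≟ᶠ N′ x)) (λ ne → ne (sym (add-fst R x y))) | 𝟙-yes (x ≟ᶠ x) refl =
          ≤-reflexive (sym (𝟙-yes (¬? (M x ≟ᶠ N x)) λ eq → Mx≢x (trans eq Nx)))
      pointwise t (no t≢x) (yes refl) _
        rewrite 𝟙-no (¬? (M y ≟ᶠ N′ y)) (λ ne → ne (trans My≡x (sym (add-snd R x y))))
              | 𝟙-no (x ≟ᶠ y) x≢y = z≤n
      pointwise t (no t≢x) (no t≢y) (yes refl)
        rewrite 𝟙-no (x ≟ᶠ z) x≢z =
          ≤-trans (≤-reflexive (+-identityʳ _)) (≤-trans (𝟙≤1 (¬? (M z ≟ᶠ N′ z)))
            (≤-reflexive (sym (𝟙-yes (¬? (M z ≟ᶠ N z)) λ eq →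
              x≢z (M-injective isM (sym (trans eq Nz≡y)))))))
      pointwise t (no t≢x) (no t≢y) (no t≢z)
        rewrite 𝟙-no (x ≟ᶠ t) (≢-sym t≢x) | add-other R {x} {y} t≢x t≢y | remove-other N {y} t≢y t≢z =
          ≤-reflexive (+-identityʳ _)
      closer : diff M N′ + 1 ≤ diff M N
      closer = begin
        diff M N′ + 1                                ≡⟨ cong (diff M N′ +_) (sym (δᶠ x)) ⟩
        diff M N′ + ∑[ t ∈ allFin n ] 𝟙 (x ≟ᶠ t)    ≡⟨ sym (∑-distrib-+ (allFin n) _ _) ⟩
        ∑[ t ∈ allFin n ] (𝟙 (¬? (M t ≟ᶠ N′ t)) + 𝟙 (x ≟ᶠ t))
          ≤⟨ ∑-mono (allFin n) (λ {t} _ → pointwise t (t ≟ᶠ x) (t ≟ᶠ y) (t ≟ᶠ z)) ⟩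
        diff M N                                     ∎
        where open ≤-Reasoning
      conclude : ∀ d → diff M N ≤ d → ⊥
      conclude zero    ≤0 = <⇒≱ (≤-trans (≤-reflexive (+-comm 1 (diff M N′))) (≤-trans closer ≤0)) z≤n
      conclude (suc d) ≤d = descent d isN′ N′-big N′w
        (s≤s⁻¹ (≤-trans (≤-reflexive (+-comm 1 (diff M N′))) (≤-trans closer ≤d)))

  -- The descent may start at any maximum matching that misses w, and `missed` provides one.
  ∼-trans : ∀ {u w v} → u ∼ w → w ∼ v → u ∼ v
  ∼-trans {u} {w} {v} u∼w w∼v u≢v (M , isM , big , Mu , Mv) with u ≟ᶠ w | w ≟ᶠ v
  ... | yes refl | _ = w∼v u≢v (M , isM , big , Mu , Mv)
  ... | no _ | yes refl = u∼w u≢v (M , isM , big , Mu , Mv)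
  ... | no u≢w | no w≢v =
    let N , isN , N-big , Nw , _ = missed w
    in descent u∼w w∼v u≢v u≢w w≢v isM big Mu Mv (diff M N) isN N-big Nw ≤-refl

-- Degree sums under bounded degree and matching number.

module _ {n : ℕ} {E : Fin n → Fin n → Set} (E? : Decidable₂ E) where

  degree : Fin n → ℕ
  degree x = ∑[ y ∈ allFin n ] 𝟙 (E? x y)

  degreeSum : ℕ
  degreeSum = ∑[ x ∈ allFin n ] degree x

module FactorCritical
  {n : ℕ} {E : Fin n → Fin n → Set} (E? : Decidable₂ E) (E-sym : Symmetric E)
  (E-irrefl : ∀ {x y} → E x y → x ≢ y) (k : ℕ)
  (bounded : ∀ M → IsMatching E M → covered M < 2 * suc k)
  (missed : ∀ v → Misses {E = E} k v v)
  (Δ : ℕ) (degree≤Δ : ∀ x → degree E? x ≤ Δ)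
  {M : Mate n} (isM : IsMatching E M) (M-big : 2 * k ≤ covered M) where

  open Gallai E? E-sym E-irrefl k bounded missed

  -- `Fixed` vertices are those missed by M, at most one per class. Moved vertices and `Big` ones
  -- may contribute Δ each to the degree sum; the degree of a `Small` one must be paid by its
  -- neighbours, which have slack because the class is too small for degree Δ.
  Fixed Big Small : Fin n → Set
  Fixed x = M x ≡ x

  moved? : ∀ x → Dec (¬ Fixed x)
  moved? x = ¬? (M x ≟ᶠ x)

  InClass : Fin n → Fin n → Set
  InClass w x = w ∼ x × ¬ Fixed x

  inClass? : Decidable₂ InClass
  inClass? w x = (w ∼? x) ×-dec moved? x

  classSize : Fin n → ℕ
  classSize w = ∑[ x ∈ allFin n ] 𝟙 (inClass? w x)

  Big   w = Fixed w × Δ ≤ classSize w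
  Small w = Fixed w × ¬ (Δ ≤ classSize w)

  big? : Decidable Big
  big? w = (M w ≟ᶠ w) ×-dec (Δ ≤? classSize w)

  small? : Decidable Small
  small? w = (M w ≟ᶠ w) ×-dec ¬? (Δ ≤? classSize w)

  fixed-unique : ∀ {w w′ x} → Fixed w → Fixed w′ → w ∼ x → w′ ∼ x → w ≡ w′
  fixed-unique Mw Mw′ w∼x w′∼x = ∼-apart (∼-trans w∼x (∼-sym w′∼x)) isM M-big Mw Mw′

  bigCount : ℕ
  bigCount = ∑[ w ∈ allFin n ] 𝟙 (big? w)

  -- Distinct missed vertices have disjoint classes, and each big class uses at least Δ of the at
  -- most 2k covered vertices.
  bigCount-bound : bigCount * Δ ≤ 2 * k
  bigCount-bound = begin
    bigCount * Δ
      ≡⟨ sym (∑-distribʳ-* (allFin n) _ Δ) ⟩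
    ∑[ w ∈ allFin n ] (𝟙 (big? w) * Δ)
      ≤⟨ ∑-mono (allFin n) (λ {w} _ → row w) ⟩
    ∑[ w ∈ allFin n ] ∑[ x ∈ allFin n ] 𝟙 ((M w ≟ᶠ w) ×-dec inClass? w x)
      ≡⟨ ∑-swap (allFin n) (allFin n) _ ⟩
    ∑[ x ∈ allFin n ] ∑[ w ∈ allFin n ] 𝟙 ((M w ≟ᶠ w) ×-dec inClass? w x)
      ≤⟨ ∑-mono (allFin n) (λ {x} _ → ∑-𝟙-unique (λ w → (M w ≟ᶠ w) ×-dec inClass? w x) (moved? x) (allFin⁺ n)
           (λ _ (_ , _ , ¬Mx) → ¬Mx)
           (λ _ _ (Mw , w∼x , _) (Mw′ , w′∼x , _) → fixed-unique Mw Mw′ w∼x w′∼x)) ⟩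
    covered M
      ≤⟨ covered-max isM ⟩
    2 * k ∎
    where
    open ≤-Reasoning
    row : ∀ w → 𝟙 (big? w) * Δ ≤ ∑[ x ∈ allFin n ] 𝟙 ((M w ≟ᶠ w) ×-dec inClass? w x)
    row w with big? w
    ... | no _ = z≤n
    ... | yes (Mw , big) = ≤-trans (≤-reflexive (+-identityʳ Δ)) (≤-trans big
      (∑-mono (allFin n) λ {x} _ → 𝟙-mono (inClass? w x) ((M w ≟ᶠ w) ×-dec inClass? w x) (Mw ,_)))

  SmallNeighbour : Fin n → Fin n → Set
  SmallNeighbour x w = Small w × E w x

  smallNeighbour? : Decidable₂ SmallNeighbour
  smallNeighbour? x w = small? w ×-dec E? w x

  smallDegree : Fin n → ℕ
  smallDegree x = ∑[ w ∈ allFin n ] 𝟙 (smallNeighbour? x w)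

  smallDegree-sum : ∑[ x ∈ allFin n ] smallDegree x ≡ ∑[ w ∈ allFin n ] (𝟙 (small? w) * degree E? w)
  smallDegree-sum = trans (∑-swap (allFin n) (allFin n) _) (∑-cong (allFin n) row)
    where
    row : ∀ w → ∑[ x ∈ allFin n ] 𝟙 (smallNeighbour? x w) ≡ 𝟙 (small? w) * degree E? w
    row w with small? w
    ... | no _ = ∑-≡0 (allFin n) (λ _ → refl)
    ... | yes s = trans (∑-cong (allFin n) λ x → ≤-antisym
        (𝟙-mono (yes s ×-dec E? w x) (E? w x) proj₂)
        (𝟙-mono (E? w x) (yes s ×-dec E? w x) (s ,_)))
      (sym (+-identityʳ _))

  -- A neighbour x of a missed vertex w whose class has at most Δ vertices has
  -- all its neighbours in that class, so it can pay one unit of deg w.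
  charge : ∀ {x} → ¬ Fixed x → degree E? x + smallDegree x ≤ Δ
  charge {x} ¬Mx with any? (smallNeighbour? x)
  ... | no none = ≤-trans (≤-reflexive (trans (cong (degree E? x +_)
        (∑-≡0 (allFin n) λ {w} _ → 𝟙-no (smallNeighbour? x w) (λ s → none (w , s)))) (+-identityʳ _)))
      (degree≤Δ x)
  ... | yes (w , (Mw , small) , Ewx) = begin
    degree E? x + smallDegree x
      ≤⟨ +-monoʳ-≤ (degree E? x) (∑-𝟙≤1 (smallNeighbour? x) (allFin⁺ n)
           λ _ _ ((Mv , _) , Evx) ((Mv′ , _) , Ev′x) → fixed-unique Mv Mv′ (E⇒∼ Evx) (E⇒∼ Ev′x)) ⟩
    degree E? x + 1
      ≡⟨ cong (degree E? x +_) (sym (δᶠ x)) ⟩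
    degree E? x + ∑[ y ∈ allFin n ] 𝟙 (x ≟ᶠ y)
      ≡⟨ sym (∑-distrib-+ (allFin n) _ _) ⟩
    ∑[ y ∈ allFin n ] (𝟙 (E? x y) + 𝟙 (x ≟ᶠ y))
      ≤⟨ ∑-mono (allFin n) (λ {y} _ → pointwise y (x ≟ᶠ y) (E? x y)) ⟩
    ∑[ y ∈ allFin n ] (𝟙 (inClass? w y) + 𝟙 (w ≟ᶠ y))
      ≡⟨ ∑-distrib-+ (allFin n) _ _ ⟩
    classSize w + ∑[ y ∈ allFin n ] 𝟙 (w ≟ᶠ y)
      ≡⟨ trans (cong (classSize w +_) (δᶠ w)) (+-comm _ 1) ⟩
    suc (classSize w)
      ≤⟨ ≰⇒> small ⟩
    Δ ∎
    where
    open ≤-Reasoning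
    pointwise : ∀ y → Dec (x ≡ y) → Dec (E x y) →
                𝟙 (E? x y) + 𝟙 (x ≟ᶠ y) ≤ 𝟙 (inClass? w y) + 𝟙 (w ≟ᶠ y)
    pointwise y (yes refl) _
      rewrite 𝟙-no (E? x x) (λ Exx → E-irrefl Exx refl) | 𝟙-yes (x ≟ᶠ x) refl
            | 𝟙-yes (inClass? w x) (E⇒∼ Ewx , ¬Mx) = s≤s z≤n
    pointwise y (no x≢y) (no ¬Exy)
      rewrite 𝟙-no (E? x y) ¬Exy | 𝟙-no (x ≟ᶠ y) x≢y = z≤n
    pointwise y (no x≢y) (yes Exy)
      rewrite 𝟙-no (x ≟ᶠ y) x≢y = ≤-trans (≤-reflexive (+-identityʳ _)) (𝟙-≤ (E? x y) λ _ → member (M y ≟ᶠ y))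
      where
      w∼y : w ∼ y
      w∼y = ∼-trans (E⇒∼ Ewx) (E⇒∼ Exy)
      member : Dec (M y ≡ y) → 1 ≤ 𝟙 (inClass? w y) + 𝟙 (w ≟ᶠ y)
      member (yes My) = ≤-trans (≤-reflexive (sym (𝟙-yes (w ≟ᶠ y) (∼-apart w∼y isM M-big Mw My)))) (m≤n+m _ _)
      member (no ¬My) = ≤-trans (≤-reflexive (sym (𝟙-yes (inClass? w y) (w∼y , ¬My)))) (m≤m+n _ _)

  -- Discharging: `smallDegree` is added to both sides. On the left it is absorbed vertex by vertex
  -- through `charge`; on the right its total equals the degrees of the small vertices, so it
  -- cancels.
  degreeSum-bound : degreeSum E? ≤ Δ * (2 * k + bigCount)
  degreeSum-bound = +-cancelʳ-≤ (∑[ x ∈ allFin n ] smallDegree x) _ _ (begin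
    degreeSum E? + ∑[ x ∈ allFin n ] smallDegree x
      ≡⟨ sym (∑-distrib-+ (allFin n) _ _) ⟩
    ∑[ x ∈ allFin n ] (degree E? x + smallDegree x)
      ≤⟨ ∑-mono (allFin n) (λ {x} _ → pointwise x (M x ≟ᶠ x) (Δ ≤? classSize x)) ⟩
    ∑[ x ∈ allFin n ] (𝟙 (moved? x) * Δ + 𝟙 (big? x) * Δ + 𝟙 (small? x) * degree E? x)
      ≡⟨ trans (∑-distrib-+ (allFin n) _ _) (cong₂ _+_ (∑-distrib-+ (allFin n) _ _) refl) ⟩
    ∑[ x ∈ allFin n ] (𝟙 (moved? x) * Δ) + ∑[ x ∈ allFin n ] (𝟙 (big? x) * Δ) +
      ∑[ x ∈ allFin n ] (𝟙 (small? x) * degree E? x)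
      ≡⟨ cong₂ _+_ (cong₂ _+_ (∑-distribʳ-* (allFin n) _ Δ) (∑-distribʳ-* (allFin n) _ Δ)) (sym smallDegree-sum) ⟩
    covered M * Δ + bigCount * Δ + ∑[ x ∈ allFin n ] smallDegree x
      ≡⟨ cong (_+ ∑[ x ∈ allFin n ] smallDegree x) (trans (sym (*-distribʳ-+ Δ (covered M) bigCount)) (*-comm _ Δ)) ⟩
    Δ * (covered M + bigCount) + ∑[ x ∈ allFin n ] smallDegree x
      ≤⟨ +-monoˡ-≤ _ (*-monoʳ-≤ Δ (+-monoˡ-≤ bigCount (covered-max isM))) ⟩
    Δ * (2 * k + bigCount) + ∑[ x ∈ allFin n ] smallDegree x ∎)
    where
    open ≤-Reasoning
    pointwise : ∀ x → Dec (M x ≡ x) → Dec (Δ ≤ classSize x) →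
      degree E? x + smallDegree x ≤ 𝟙 (moved? x) * Δ + 𝟙 (big? x) * Δ + 𝟙 (small? x) * degree E? x
    pointwise x (no ¬Mx) _
      rewrite 𝟙-yes (moved? x) ¬Mx =
        ≤-trans (charge ¬Mx) (≤-trans (≤-reflexive (sym (+-identityʳ Δ))) (≤-trans (m≤m+n (Δ + 0) _) (m≤m+n (Δ + 0 + _) _)))
    pointwise x (yes Mx) size =
      ≤-trans (≤-reflexive (trans (cong (degree E? x +_) none) (+-identityʳ _))) (fixed size)
      where
      none : smallDegree x ≡ 0
      -- Two vertices missed by M in one class coincide, so a missed vertex has no missed neighbour.
      none = ∑-≡0 (allFin n) λ {w} _ → 𝟙-no (smallNeighbour? x w) λ ((Mw , _) , Ewx) →
        E-irrefl Ewx (∼-apart (E⇒∼ Ewx) isM M-big Mw Mx)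
      fixed : Dec (Δ ≤ classSize x) →
        degree E? x ≤ 𝟙 (moved? x) * Δ + 𝟙 (big? x) * Δ + 𝟙 (small? x) * degree E? x
      fixed (yes big) rewrite 𝟙-yes (big? x) (Mx , big) =
        ≤-trans (degree≤Δ x) (≤-trans (≤-reflexive (sym (+-identityʳ Δ)))
          (≤-trans (m≤n+m (Δ + 0) (𝟙 (moved? x) * Δ)) (m≤m+n (𝟙 (moved? x) * Δ + (Δ + 0)) _)))
      fixed (no small) rewrite 𝟙-yes (small? x) (Mx , small) =
        ≤-trans (≤-reflexive (sym (+-identityʳ _))) (m≤n+m _ (𝟙 (moved? x) * Δ + 𝟙 (big? x) * Δ))

-- The vertex set stays the same and v becomes isolated, so the induction on k requires no
-- relabelling.
Delete : ∀ {n} → (Fin n → Fin n → Set) → Fin n → Fin n → Fin n → Set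
Delete E v x y = E x y × x ≢ v × y ≢ v

delete? : ∀ {n} {E : Fin n → Fin n → Set} → Decidable₂ E → ∀ v → Decidable₂ (Delete E v)
delete? E? v x y = E? x y ×-dec ¬? (x ≟ᶠ v) ×-dec ¬? (y ≟ᶠ v)

degreeSum-delete : ∀ {n} {E : Fin n → Fin n → Set} (E? : Decidable₂ E) → Symmetric E → ∀ v →
  degreeSum E? ≤ degreeSum (delete? E? v) + (degree E? v + degree E? v)
degreeSum-delete {n} {E} E? E-sym v = begin
    degreeSum E?
      ≤⟨ ∑-mono V (λ {x} _ → ∑-mono V (λ {y} _ → pointwise x y)) ⟩
    ∑[ x ∈ V ] ∑[ y ∈ V ] (𝟙 (E′? x y) + (𝟙 (v ≟ᶠ x) * 𝟙 (E? v y) + 𝟙 (v ≟ᶠ y) * 𝟙 (E? v x)))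
      ≡⟨ ∑-cong V (λ x → trans (∑-distrib-+ V _ _) (cong (degree E′? x +_) (∑-distrib-+ V _ _))) ⟩
    ∑[ x ∈ V ] (degree E′? x + (∑[ y ∈ V ] (𝟙 (v ≟ᶠ x) * 𝟙 (E? v y)) + ∑[ y ∈ V ] (𝟙 (v ≟ᶠ y) * 𝟙 (E? v x))))
      ≡⟨ trans (∑-distrib-+ V _ _) (cong (degreeSum E′? +_) (∑-distrib-+ V _ _)) ⟩
    degreeSum E′? + (∑[ x ∈ V ] ∑[ y ∈ V ] (𝟙 (v ≟ᶠ x) * 𝟙 (E? v y)) + ∑[ x ∈ V ] ∑[ y ∈ V ] (𝟙 (v ≟ᶠ y) * 𝟙 (E? v x)))
      ≡⟨ cong (degreeSum E′? +_) (cong₂ _+_ loop₁ (trans (∑-swap V V _) loop₁)) ⟩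
    degreeSum E′? + (degree E? v + degree E? v) ∎
  where
  open ≤-Reasoning
  V = allFin n
  E′? = delete? E? v
  pointwise : ∀ x y → 𝟙 (E? x y) ≤ 𝟙 (E′? x y) + (𝟙 (v ≟ᶠ x) * 𝟙 (E? v y) + 𝟙 (v ≟ᶠ y) * 𝟙 (E? v x))
  pointwise x y with v ≟ᶠ x | v ≟ᶠ y
  ... | yes refl | _ = ≤-trans (≤-trans (m≤m+n _ 0) (m≤m+n (𝟙 (E? v y) + 0) _)) (m≤n+m _ (𝟙 (E′? v y)))
  ... | no _ | yes refl = ≤-trans (≤-trans (𝟙-mono (E? x v) (E? v x) E-sym) (m≤m+n _ 0)) (m≤n+m _ (𝟙 (E′? x v)))
  ... | no v≢x | no v≢y = ≤-trans (𝟙-mono (E? x y) (E′? x y) λ e → e , ≢-sym v≢x , ≢-sym v≢y) (m≤m+n _ _)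
  loop₁ : ∑[ x ∈ V ] ∑[ y ∈ V ] (𝟙 (v ≟ᶠ x) * 𝟙 (E? v y)) ≡ degree E? v
  loop₁ = trans (∑-cong V λ x → trans (∑-cong V λ y → *-comm (𝟙 (v ≟ᶠ x)) _) (trans (∑-distribʳ-* V _ (𝟙 (v ≟ᶠ x))) (*-comm _ (𝟙 (v ≟ᶠ x)))))
    (trans (∑-distribʳ-* V _ (degree E? v)) (trans (cong (_* degree E? v) (δᶠ v)) (*-identityˡ _)))

-- Since b ≤ ⌊2k / Δ⌋, this is the Chvátal–Hanson bound when Δ is even.
degreeSum-matching : ∀ {n} k {E : Fin n → Fin n → Set} (E? : Decidable₂ E) → Symmetric E →
  (∀ {x y} → E x y → x ≢ y) → ∀ Δ → (∀ x → degree E? x ≤ Δ) →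
  (∀ M → IsMatching E M → covered M < 2 * suc k) →
  ∃[ b ] b * Δ ≤ 2 * k × degreeSum E? ≤ Δ * (2 * k + b)
degreeSum-matching {zero} k E? E-sym E-irrefl Δ deg bounded = 0 , z≤n , z≤n
degreeSum-matching {suc n} k {E} E? E-sym E-irrefl Δ deg bounded with all? (λ v → misses? E? k v v)
... | yes missed =
  let M , isM , big , _ = missed zero
      open FactorCritical E? E-sym E-irrefl k bounded missed Δ deg isM big
  in bigCount , bigCount-bound , degreeSum-bound
... | no ¬missed with ¬∀⟶∃¬ (suc n) _ (λ v → misses? E? k v v) ¬missed
-- For k = 0 the empty matching, given by the identity, is maximum and misses every vertex.
degreeSum-matching {suc n} zero {E} E? E-sym E-irrefl Δ deg bounded | no _ | v , v-covered =
  contradiction (id , record { involutive = λ _ → refl ; edge = λ ne → contradiction refl ne } , z≤n , refl , refl) v-covered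
degreeSum-matching {suc n} (suc k) {E} E? E-sym E-irrefl Δ deg bounded | no _ | v , v-covered =
  let b , bΔ≤ , sum≤ = degreeSum-matching k E′? (λ (e , p , q) → E-sym e , q , p) (λ (e , _) → E-irrefl e) Δ deg′ bounded′
  in b , ≤-trans bΔ≤ (*-monoʳ-≤ 2 (n≤1+n k)) , total b sum≤
  where
  E′ : Fin (suc n) → Fin (suc n) → Set
  E′ = Delete E v
  E′? : Decidable₂ E′
  E′? = delete? E? v
  deg′ : ∀ x → degree E′? x ≤ Δ
  deg′ x = ≤-trans (∑-mono (allFin (suc n)) λ {y} _ → 𝟙-mono (E′? x y) (E? x y) proj₁) (deg x)
  bounded′ : ∀ M → IsMatching E′ M → covered M < 2 * suc k
  -- A matching of the smaller graph with k + 1 edges would be a maximum matching of the original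
  -- one that misses v.
  bounded′ M isM′ = ≰⇒> λ big → v-covered (M , isM , big , Mv , Mv)
    where
    open IsMatching isM′
    isM : IsMatching E M
    isM = record { involutive = involutive ; edge = λ ne → proj₁ (edge ne) }
    Mv : M v ≡ v
    Mv = decidable-stable (M v ≟ᶠ v) λ ne → proj₁ (proj₂ (edge ne)) refl
  total : ∀ b → degreeSum E′? ≤ Δ * (2 * k + b) → degreeSum E? ≤ Δ * (2 * suc k + b)
  total b sum≤ = begin
    degreeSum E?
      ≤⟨ degreeSum-delete E? E-sym v ⟩
    degreeSum E′? + (degree E? v + degree E? v)
      ≤⟨ +-mono-≤ sum≤ (+-mono-≤ (deg v) (deg v)) ⟩
    Δ * (2 * k + b) + (Δ + Δ)
      ≡⟨ double Δ k b ⟩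
    Δ * (2 * suc k + b) ∎
    where
    open ≤-Reasoning
    double : ∀ d l c → d * (2 * l + c) + (d + d) ≡ d * (2 * suc l + c)
    double = solve-∀

-- Triples, and sunflowers grown petal by petal.

infix 4 _≟ˢ_
_≟ˢ_ : ∀ {n} → DecidableEquality (Subset n)
_≟ˢ_ = ≡-dec _≟ᵇ_

lookup-injective : ∀ {A : Set} {xs : List A} → Unique xs → ∀ {i j} → List.lookup xs i ≡ List.lookup xs j → i ≡ j
lookup-injective (_  ∷ _) {zero}  {zero}  eq = refl
lookup-injective (x∉ ∷ _) {zero}  {suc j} eq = contradiction eq (All.lookup x∉ (∈-lookup j))
lookup-injective (x∉ ∷ _) {suc i} {zero}  eq = contradiction (sym eq) (All.lookup x∉ (∈-lookup i))
lookup-injective (_  ∷ u) {suc i} {suc j} eq = cong suc (lookup-injective u eq)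

module _ {n : ℕ} where

  elements : Subset n → List (Fin n)
  elements s = filter (_∈? s) (allFin n)

  ∈-elements : ∀ {s x} → x ∈ˢ s → x ∈ elements s
  ∈-elements {s} {x} = ∈-filter⁺ (_∈? s) (∈-allFin x)

  length-elements : ∀ s → length (elements s) ≡ ∣ s ∣
  length-elements s = trans (length-filter (_∈? s) (allFin n)) (sym (∣∣≡∑ s))

  private variable
    A B C : Subset n
    v w x y z : Fin n

  triple : ∣ A ∣ ≡ 3 → ∃[ x ] ∃[ y ] ∃[ z ] (x ≢ y × x ≢ z × y ≢ z) × x ∈ˢ A × y ∈ˢ A × z ∈ˢ A
  triple {A} ∣A∣≡3 = go (elements A) (filter⁺ (_∈? A) (allFin⁺ n))
    (proj₂ ∘ ∈-filter⁻ (_∈? A) {xs = allFin n}) (trans (length-elements A) ∣A∣≡3)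
    where
    go : ∀ xs → Unique xs → (∀ {t} → t ∈ xs → t ∈ˢ A) → length xs ≡ 3 →
         ∃[ x ] ∃[ y ] ∃[ z ] (x ≢ y × x ≢ z × y ≢ z) × x ∈ˢ A × y ∈ˢ A × z ∈ˢ A
    go (x ∷ y ∷ z ∷ []) ((x≢y ∷ x≢z ∷ []) ∷ (y≢z ∷ []) ∷ _) sub refl =
      x , y , z , (x≢y , x≢z , y≢z) , sub (here refl) , sub (there (here refl)) , sub (there (there (here refl)))

  no-fourth : ∣ A ∣ ≡ 3 → x ≢ y → x ≢ z → y ≢ z → x ∈ˢ A → y ∈ˢ A → z ∈ˢ A →
              ∀ {t} → t ∈ˢ A → t ≡ x ⊎ t ≡ y ⊎ t ≡ z
  no-fourth {A} {x} {y} {z} ∣A∣≡3 x≢y x≢z y≢z x∈ y∈ z∈ {t} t∈ with t ≟ᶠ x | t ≟ᶠ y | t ≟ᶠ z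
  ... | yes t≡x | _ | _ = inj₁ t≡x
  ... | no _ | yes t≡y | _ = inj₂ (inj₁ t≡y)
  ... | no _ | no _ | yes t≡z = inj₂ (inj₂ t≡z)
  ... | no t≢x | no t≢y | no t≢z = contradiction
    (≤-trans (length-⊆ _≟ᶠ_ {xs = t ∷ x ∷ y ∷ z ∷ []}
      ((t≢x ∷ t≢y ∷ t≢z ∷ []) ∷ (x≢y ∷ x≢z ∷ []) ∷ (y≢z ∷ []) ∷ [] ∷ []) sub)
      (≤-reflexive (trans (length-elements A) ∣A∣≡3)))
    (<⇒≱ ≤-refl)
    where
    sub : ∀ {s} → s ∈ t ∷ x ∷ y ∷ z ∷ [] → s ∈ elements A
    sub (here refl) = ∈-elements t∈
    sub (there (here refl)) = ∈-elements x∈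
    sub (there (there (here refl))) = ∈-elements y∈
    sub (there (there (there (here refl)))) = ∈-elements z∈

  two-others : ∣ A ∣ ≡ 3 → v ∈ˢ A → ∃[ x ] ∃[ y ] (v ≢ x × v ≢ y × x ≢ y) × x ∈ˢ A × y ∈ˢ A
  two-others {A} ∣A∣≡3 v∈ with triple {A} ∣A∣≡3
  ... | x , y , z , (x≢y , x≢z , y≢z) , x∈ , y∈ , z∈ with no-fourth {A} ∣A∣≡3 x≢y x≢z y≢z x∈ y∈ z∈ v∈
  ...   | inj₁ refl = y , z , (x≢y , x≢z , y≢z) , y∈ , z∈
  ...   | inj₂ (inj₁ refl) = x , z , (≢-sym x≢y , y≢z , x≢z) , x∈ , z∈
  ...   | inj₂ (inj₂ refl) = x , y , (≢-sym x≢z , ≢-sym y≢z , x≢y) , x∈ , y∈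

  triple-⊆ : ∣ A ∣ ≡ 3 → x ≢ y → x ≢ z → y ≢ z → x ∈ˢ A → y ∈ˢ A → z ∈ˢ A →
             x ∈ˢ B → y ∈ˢ B → z ∈ˢ B → ∀ {t} → t ∈ˢ A → t ∈ˢ B
  triple-⊆ {A} ∣A∣≡3 x≢y x≢z y≢z x∈ y∈ z∈ x∈B y∈B z∈B t∈ with no-fourth {A} ∣A∣≡3 x≢y x≢z y≢z x∈ y∈ z∈ t∈
  ... | inj₁ refl = x∈B
  ... | inj₂ (inj₁ refl) = y∈B
  ... | inj₂ (inj₂ refl) = z∈B

  triple-≡ : ∣ A ∣ ≡ 3 → ∣ B ∣ ≡ 3 → x ≢ y → x ≢ z → y ≢ z → x ∈ˢ A → y ∈ˢ A → z ∈ˢ A →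
             x ∈ˢ B → y ∈ˢ B → z ∈ˢ B → A ≡ B
  triple-≡ {A} {B} ∣A∣≡3 ∣B∣≡3 x≢y x≢z y≢z x∈ y∈ z∈ x∈B y∈B z∈B = ⊆-antisym
    (triple-⊆ {A} {B = B} ∣A∣≡3 x≢y x≢z y≢z x∈ y∈ z∈ x∈B y∈B z∈B)
    (triple-⊆ {B} {B = A} ∣B∣≡3 x≢y x≢z y≢z x∈B y∈B z∈B x∈ y∈ z∈)

  Meet : Subset n → Subset n → Subset n → Set
  Meet C A B = ∀ {w} → w ∈ˢ A → w ∈ˢ B → w ∈ˢ C

  -- A sunflower as a list that can be extended by one set. Here `meet` is only an inclusion, the
  -- converse being `core⊆`. With core `∅` these are the families of pairwise disjoint sets.
  record Petals (C : Subset n) (As : List (Subset n)) : Set where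
    field
      distinct : Unique As
      core⊆    : ∀ {A w} → A ∈ As → w ∈ˢ C → w ∈ˢ A
      meet     : ∀ {A B} → A ∈ As → B ∈ As → A ≢ B → Meet C A B

  petals-[] : Petals C []
  petals-[] = record { distinct = [] ; core⊆ = λ () ; meet = λ () }

  petals-∷ : ∀ {As} → (∀ {w} → w ∈ˢ C → w ∈ˢ A) → (∀ {B} → B ∈ As → A ≢ B × Meet C A B) →
             Petals C As → Petals C (A ∷ As)
  petals-∷ {C} {A} {As} C⊆A apart P = record
    { distinct = All.tabulate (λ B∈ → proj₁ (apart B∈)) ∷ distinct
    ; core⊆    = λ { (here refl) → C⊆A ; (there B∈) → core⊆ B∈ }
    ; meet     = meets
    }
    where
    open Petals P
    meets : ∀ {B D} → B ∈ A ∷ As → D ∈ A ∷ As → B ≢ D → Meet C B D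
    meets (here refl) (here refl) B≢D = contradiction refl B≢D
    meets (here refl) (there D∈) _ = proj₂ (apart D∈)
    meets (there B∈) (here refl) _ w∈B w∈A = proj₂ (apart B∈) w∈A w∈B
    meets (there B∈) (there D∈) = meet B∈ D∈

  petals-filter : ∀ {P : Subset n → Set} (P? : Decidable P) {As} → Petals C As → Petals C (filter P? As)
  petals-filter P? P = record
    { distinct = filter⁺ P? distinct
    ; core⊆    = λ A∈ → core⊆ (proj₁ (∈-filter⁻ P? A∈))
    ; meet     = λ A∈ B∈ → meet (proj₁ (∈-filter⁻ P? A∈)) (proj₁ (∈-filter⁻ P? B∈))
    }
    where open Petals P

  petals-sunflower : ∀ {k F As} → Petals C As → (∀ {A} → A ∈ As → A ∈ F) → k ≤ length As →
                     ContainsSunflower k F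
  petals-sunflower {C} {As = As} P As⊆F k≤ = petal , record
    { distinct = λ eq → inject≤-injective k≤ k≤ _ _ (lookup-injective distinct eq)
    ; core     = C
    ; meet     = λ {i} {j} i≢j → ⊆-antisym
        (λ w∈ → let w∈i , w∈j = x∈p∩q⁻ (petal i) (petal j) w∈ in
          meet (∈-lookup (inject≤ i k≤)) (∈-lookup (inject≤ j k≤))
            (λ eq → i≢j (inject≤-injective k≤ k≤ _ _ (lookup-injective distinct eq))) w∈i w∈j)
        (λ w∈ → x∈p∩q⁺ (core⊆ (∈-lookup (inject≤ i k≤)) w∈ , core⊆ (∈-lookup (inject≤ j k≤)) w∈))
    } , λ i → As⊆F (∈-lookup (inject≤ i k≤))
    where
    open Petals P
    petal = λ i → List.lookup As (inject≤ i k≤)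

-- Links of points in a family of triples.

module Family {n : ℕ} {F : List (Subset n)} (free : SunflowerFree 3 7 F) where

  open SunflowerFree free

  size : ∀ {A} → A ∈ F → ∣ A ∣ ≡ 3
  size = All.lookup uniform

  few-petals : ∀ {C As} → Petals C As → (∀ {A} → A ∈ As → A ∈ F) → length As ≤ 6
  few-petals P As⊆F = s≤s⁻¹ (≰⇒> λ many → noSunflower (petals-sunflower P As⊆F many))

  -- Distinct triples through x and y share no third point, so they form a sunflower with core {x,
  -- y}.
  pair-degree : ∀ {G x y} → Unique G → (∀ {A} → A ∈ G → A ∈ F) → x ≢ y →
                (∀ {A} → A ∈ G → x ∈ˢ A × y ∈ˢ A) → length G ≤ 6
  pair-degree {G} {x} {y} uniq G⊆F x≢y xy∈ = few-petals {⁅ x ⁆ ∪ ⁅ y ⁆} P G⊆F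
    where
    x∈C : x ∈ˢ ⁅ x ⁆ ∪ ⁅ y ⁆
    x∈C = x∈p∪q⁺ (inj₁ (x∈⁅x⁆ x))
    y∈C : y ∈ˢ ⁅ x ⁆ ∪ ⁅ y ⁆
    y∈C = x∈p∪q⁺ (inj₂ (x∈⁅x⁆ y))
    core : ∀ {A w} → A ∈ G → w ∈ˢ ⁅ x ⁆ ∪ ⁅ y ⁆ → w ∈ˢ A
    core A∈ w∈ with x∈p∪q⁻ ⁅ x ⁆ ⁅ y ⁆ w∈
    ... | inj₁ w∈x rewrite x∈⁅y⁆⇒x≡y x w∈x = proj₁ (xy∈ A∈)
    ... | inj₂ w∈y rewrite x∈⁅y⁆⇒x≡y y w∈y = proj₂ (xy∈ A∈)
    meets : ∀ {A B} → A ∈ G → B ∈ G → A ≢ B → Meet (⁅ x ⁆ ∪ ⁅ y ⁆) A B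
    meets {A} {B} A∈ B∈ A≢B {w} w∈A w∈B with x ≟ᶠ w | y ≟ᶠ w
    ... | yes refl | _ = x∈C
    ... | no _ | yes refl = y∈C
    ... | no x≢w | no y≢w = contradiction
      (triple-≡ {A = A} {B} (size (G⊆F A∈)) (size (G⊆F B∈)) x≢y x≢w y≢w
        (proj₁ (xy∈ A∈)) (proj₂ (xy∈ A∈)) w∈A (proj₁ (xy∈ B∈)) (proj₂ (xy∈ B∈)) w∈B) A≢B
    P : Petals (⁅ x ⁆ ∪ ⁅ y ⁆) G
    P = record { distinct = uniq ; core⊆ = core ; meet = meets }

  -- `G` is left general: the graph bound is applied to all members through a point, and again to
  -- those that meet the maximum matching only in that point.
  module Link {v : Fin n} {G : List (Subset n)} (uniq : Unique G)
              (G⊆F : ∀ {A} → A ∈ G → A ∈ F) (v∈ : ∀ {A} → A ∈ G → v ∈ˢ A) where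

    -- For a triple A through v this says A = {v, x, y}; the inequalities make xy a genuine edge and
    -- leave v isolated in the link.
    Joined : Fin n → Fin n → Subset n → Set
    Joined x y A = (x ≢ y × x ≢ v × y ≢ v) × x ∈ˢ A × y ∈ˢ A

    joined? : ∀ x y → Decidable (Joined x y)
    joined? x y A = (¬? (x ≟ᶠ y) ×-dec ¬? (x ≟ᶠ v) ×-dec ¬? (y ≟ᶠ v)) ×-dec (x ∈? A) ×-dec (y ∈? A)

    E : Fin n → Fin n → Set
    E x y = Any (Joined x y) G

    E? : Decidable₂ E
    E? x y = anyᴸ? (joined? x y) G

    joined-sym : ∀ {x y A} → Joined x y A → Joined y x A
    joined-sym ((x≢y , x≢v , y≢v) , x∈ , y∈) = (≢-sym x≢y , y≢v , x≢v) , y∈ , x∈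

    E-sym : Symmetric E
    E-sym = Any.map joined-sym

    E-irrefl : ∀ {x y} → E x y → x ≢ y
    E-irrefl e = let _ , _ , (x≢y , _) , _ = find e in x≢y

    joined-unique : ∀ {x y A B} → A ∈ G → B ∈ G → Joined x y A → Joined x y B → A ≡ B
    joined-unique {A = A} {B} A∈ B∈ ((x≢y , x≢v , y≢v) , xA , yA) (_ , xB , yB) =
      triple-≡ {A = A} {B} (size (G⊆F A∈)) (size (G⊆F B∈)) x≢y x≢v y≢v xA yA (v∈ A∈) xB yB (v∈ B∈)

    joined-other : ∀ {x y z A} → A ∈ G → Joined x y A → Joined x z A → y ≡ z
    joined-other {x} {y} {z} {A} A∈ ((x≢y , x≢v , y≢v) , x∈ , y∈) ((x≢z , _ , z≢v) , _ , z∈)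
      with no-fourth {A = A} (size (G⊆F A∈)) x≢y x≢v y≢v x∈ y∈ (v∈ A∈) z∈
    ... | inj₁ z≡x = contradiction (sym z≡x) x≢z
    ... | inj₂ (inj₁ z≡y) = sym z≡y
    ... | inj₂ (inj₂ z≡v) = contradiction z≡v z≢v

    through? : ∀ x → Decidable (λ A → x ≢ v × x ∈ˢ A)
    through? x A = ¬? (x ≟ᶠ v) ×-dec (x ∈? A)

    degree≤6 : ∀ x → degree E? x ≤ 6
    degree≤6 x = begin
      degree E? x
        ≤⟨ ∑-mono (allFin n) (λ {y} _ → 𝟙-≤ (E? x y) (edge≤ y)) ⟩
      ∑[ y ∈ allFin n ] ∑[ A ∈ G ] 𝟙 (joined? x y A)
        ≡⟨ ∑-swap (allFin n) G _ ⟩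
      ∑[ A ∈ G ] ∑[ y ∈ allFin n ] 𝟙 (joined? x y A)
        ≤⟨ ∑-mono G (λ {A} A∈ → ∑-𝟙-unique (λ y → joined? x y A) (through? x A) (allFin⁺ n)
             (λ _ ((_ , x≢v , _) , x∈ , _) → x≢v , x∈) (λ _ _ → joined-other A∈)) ⟩
      ∑[ A ∈ G ] 𝟙 (through? x A)
        ≡⟨ sym (length-filter (through? x) G) ⟩
      length (filter (through? x) G)
        ≤⟨ few (x ≟ᶠ v) ⟩
      6 ∎
      where
      open ≤-Reasoning
      edge≤ : ∀ y → E x y → 1 ≤ ∑[ A ∈ G ] 𝟙 (joined? x y A)
      edge≤ y e = let A , A∈ , j = find e in
        ≤-trans (≤-reflexive (sym (𝟙-yes (joined? x y A) j))) (∑-∈ (λ A → 𝟙 (joined? x y A)) A∈)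
      few : Dec (x ≡ v) → length (filter (through? x) G) ≤ 6
      few (yes x≡v) = ≤-trans (≤-reflexive (trans (length-filter (through? x) G)
        (∑-≡0 G λ {A} _ → 𝟙-no (through? x A) (λ (x≢v , _) → x≢v x≡v)))) z≤n
      few (no x≢v) = pair-degree (filter⁺ (through? x) uniq)
        (λ A∈ → G⊆F (proj₁ (∈-filter⁻ (through? x) A∈))) x≢v
        (λ A∈ → let A∈G , _ , x∈ = ∈-filter⁻ (through? x) A∈ in x∈ , v∈ A∈G)

    -- Each set gives its edge in both orders, and an ordered pair comes from only one set because
    -- it determines the triple together with v.
    2*length≤degreeSum : 2 * length G ≤ degreeSum E?
    2*length≤degreeSum = begin
      2 * length G
        ≡⟨ trans (*-comm 2 (length G)) (sym (∑-const G 2)) ⟩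
      ∑[ A ∈ G ] 2
        ≤⟨ ∑-mono G two ⟩
      ∑[ A ∈ G ] ∑[ x ∈ allFin n ] ∑[ y ∈ allFin n ] 𝟙 (joined? x y A)
        ≡⟨ ∑-swap G (allFin n) _ ⟩
      ∑[ x ∈ allFin n ] ∑[ A ∈ G ] ∑[ y ∈ allFin n ] 𝟙 (joined? x y A)
        ≡⟨ ∑-cong (allFin n) (λ x → ∑-swap G (allFin n) _) ⟩
      ∑[ x ∈ allFin n ] ∑[ y ∈ allFin n ] ∑[ A ∈ G ] 𝟙 (joined? x y A)
        ≤⟨ ∑-mono (allFin n) (λ {x} _ → ∑-mono (allFin n) λ {y} _ →
             ∑-𝟙-unique (joined? x y) (E? x y) uniq lose joined-unique) ⟩
      degreeSum E? ∎
      where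
      open ≤-Reasoning
      two : ∀ {A} → A ∈ G → 2 ≤ ∑[ x ∈ allFin n ] ∑[ y ∈ allFin n ] 𝟙 (joined? x y A)
      two {A} A∈ with two-others {A = A} (size (G⊆F A∈)) (v∈ A∈)
      ... | p , q , (v≢p , v≢q , p≢q) , p∈ , q∈ = begin
        2
          ≡⟨ cong₂ _+_ (sym (δᶠ p)) (sym (δᶠ q)) ⟩
        ∑[ x ∈ allFin n ] 𝟙 (p ≟ᶠ x) + ∑[ x ∈ allFin n ] 𝟙 (q ≟ᶠ x)
          ≡⟨ sym (∑-distrib-+ (allFin n) _ _) ⟩
        ∑[ x ∈ allFin n ] (𝟙 (p ≟ᶠ x) + 𝟙 (q ≟ᶠ x))
          ≤⟨ ∑-mono (allFin n) (λ {x} _ → row x (p ≟ᶠ x) (q ≟ᶠ x)) ⟩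
        ∑[ x ∈ allFin n ] ∑[ y ∈ allFin n ] 𝟙 (joined? x y A) ∎
        where
        j : Joined p q A
        j = (p≢q , ≢-sym v≢p , ≢-sym v≢q) , p∈ , q∈
        entry : ∀ {x y} → Joined x y A → 1 ≤ ∑[ y ∈ allFin n ] 𝟙 (joined? x y A)
        entry {x} {y} jxy = ≤-trans (≤-reflexive (sym (𝟙-yes (joined? x y A) jxy)))
          (∑-∈ (λ y → 𝟙 (joined? x y A)) (∈-allFin y))
        row : ∀ x → Dec (p ≡ x) → Dec (q ≡ x) →
              𝟙 (p ≟ᶠ x) + 𝟙 (q ≟ᶠ x) ≤ ∑[ y ∈ allFin n ] 𝟙 (joined? x y A)
        row x (yes refl) _ rewrite 𝟙-yes (p ≟ᶠ p) refl | 𝟙-no (q ≟ᶠ p) (≢-sym p≢q) = entry j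
        row x (no p≢x) (yes refl) rewrite 𝟙-no (p ≟ᶠ q) p≢x | 𝟙-yes (q ≟ᶠ q) refl = entry (joined-sym j)
        row x (no p≢x) (no q≢x) rewrite 𝟙-no (p ≟ᶠ x) p≢x | 𝟙-no (q ≟ᶠ x) q≢x = z≤n

    -- Disjoint edges of the link lift to triples meeting only in v. The last component remembers
    -- the edge behind each petal, so that the next petal can be compared with it.
    petals-of : ∀ ps → All (λ (x , y) → E x y) ps → AllPairs DisjointPairs ps →
      ∃[ As ] length As ≡ length ps × (∀ {A} → A ∈ As → A ∈ G) × Petals ⁅ v ⁆ As ×
              (∀ {A} → A ∈ As → ∃[ p ] p ∈ ps × Joined (proj₁ p) (proj₂ p) A)
    petals-of [] [] [] = [] , refl , (λ ()) , petals-[] , λ ()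
    petals-of ((x , y) ∷ ps) (e ∷ es) (d ∷ ds)
      with petals-of ps es ds | find e
    ... | As , len , As⊆G , P , origin | A , A∈ , j =
      A ∷ As , cong suc len
      , (λ { (here refl) → A∈ ; (there B∈) → As⊆G B∈ })
      , petals-∷ (λ w∈ → subst (_∈ˢ A) (sym (x∈⁅y⁆⇒x≡y v w∈)) (v∈ A∈)) apart P
      , (λ { (here refl) → (x , y) , here refl , j
           ; (there B∈) → let p , p∈ , jB = origin B∈ in p , there p∈ , jB })
      where
      on : ∀ {x y w A} → A ∈ G → Joined x y A → w ∈ˢ A → w ≡ x ⊎ w ≡ y ⊎ w ≡ v
      on {A = A} A∈ ((x≢y , x≢v , y≢v) , x∈ , y∈) = no-fourth {A = A} (size (G⊆F A∈)) x≢y x≢v y≢v x∈ y∈ (v∈ A∈)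
      v∈C : v ∈ˢ ⁅ v ⁆
      v∈C = x∈⁅x⁆ v
      meets : ∀ {B s t} → B ∈ As → Joined s t B → DisjointPairs (x , y) (s , t) → Meet ⁅ v ⁆ A B
      meets B∈ jB ((x≢s , y≢s) , (x≢t , y≢t)) w∈A w∈B with on A∈ j w∈A | on (As⊆G B∈) jB w∈B
      ... | inj₂ (inj₂ refl) | _ = v∈C
      ... | inj₁ refl | inj₁ x≡s = contradiction x≡s x≢s
      ... | inj₁ refl | inj₂ (inj₁ x≡t) = contradiction x≡t x≢t
      ... | inj₁ refl | inj₂ (inj₂ refl) = v∈C
      ... | inj₂ (inj₁ refl) | inj₁ y≡s = contradiction y≡s y≢s
      ... | inj₂ (inj₁ refl) | inj₂ (inj₁ y≡t) = contradiction y≡t y≢t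
      ... | inj₂ (inj₁ refl) | inj₂ (inj₂ refl) = v∈C
      apart : ∀ {B} → B ∈ As → A ≢ B × Meet ⁅ v ⁆ A B
      apart {B} B∈ =
        let (s , t) , p∈ , jB = origin B∈
            m = meets B∈ jB (All.lookup d p∈)
            ((_ , x≢v , _) , x∈ , _) = j
        in (λ { refl → x≢v (x∈⁅y⁆⇒x≡y v (m x∈ x∈)) }) , m

    -- Since matchings of the link lift to petals, a cap k on petals with core {v} caps the matching
    -- number; the maximum degree is 6 by `pair-degree`.
    length-bound : ∀ k → (∀ {As} → Petals ⁅ v ⁆ As → (∀ {A} → A ∈ As → A ∈ G) → length As ≤ k) →
                   ∃[ b ] b * 6 ≤ 2 * k × 2 * length G ≤ 6 * (2 * k + b)
    length-bound k few =
      let b , 6b≤ , sum≤ = degreeSum-matching k E? E-sym E-irrefl 6 degree≤6 bounded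
      in b , 6b≤ , ≤-trans 2*length≤degreeSum sum≤
      where
      bounded : ∀ M → IsMatching E M → covered M < 2 * suc k
      bounded M isM =
        let ps , len , good , disj = edgeList (covered M) M isM ≤-refl
            As , len′ , As⊆G , P , _ = petals-of ps (All.map proj₁ good) disj
        in ≤-trans (s≤s (≤-reflexive len)) (*-monoʳ-< 2 (s≤s (≤-trans (≤-reflexive (sym len′)) (few P As⊆G))))

module _ {A : Set} {P Q : A → Set} (P? : Decidable P) (Q? : Decidable Q) where

  length-cover : ∀ xs → (∀ {x} → x ∈ xs → P x ⊎ Q x) →
                 length xs ≤ length (filter P? xs) + length (filter Q? xs)
  length-cover xs cover = begin
    length xs                                          ≡⟨ trans (sym (*-identityʳ _)) (sym (∑-const xs 1)) ⟩
    ∑[ _ ∈ xs ] 1                                      ≤⟨ ∑-mono xs (λ {x} x∈ → one x (cover x∈)) ⟩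
    ∑[ x ∈ xs ] (𝟙 (P? x) + 𝟙 (Q? x))                  ≡⟨ ∑-distrib-+ xs _ _ ⟩
    ∑[ x ∈ xs ] 𝟙 (P? x) + ∑[ x ∈ xs ] 𝟙 (Q? x)        ≡⟨ sym (cong₂ _+_ (length-filter P? xs) (length-filter Q? xs)) ⟩
    length (filter P? xs) + length (filter Q? xs)      ∎
    where
    open ≤-Reasoning
    one : ∀ x → P x ⊎ Q x → 1 ≤ 𝟙 (P? x) + 𝟙 (Q? x)
    one x (inj₁ p) = ≤-trans (≤-reflexive (sym (𝟙-yes (P? x) p))) (m≤m+n _ _)
    one x (inj₂ q) = ≤-trans (≤-reflexive (sym (𝟙-yes (Q? x) q))) (m≤n+m _ _)

count-≥ : ∀ {A : Set} (_≟_ : DecidableEquality A) {P : A → Set} (P? : Decidable P) {xs ys} → Unique ys →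
          (∀ {y} → y ∈ ys → y ∈ xs × P y) → length ys ≤ ∑[ x ∈ xs ] 𝟙 (P? x)
count-≥ _≟_ P? {xs} uniq sub = ≤-trans
  (length-⊆ _≟_ uniq λ y∈ → let y∈xs , p = sub y∈ in ∈-filter⁺ P? y∈xs p)
  (≤-reflexive (length-filter P? xs))

member : ∀ {A : Set} (xs : List A) → 1 ≤ length xs → ∃[ x ] x ∈ xs
member (x ∷ _) _ = x , here refl

two-members : ∀ {A : Set} {xs : List A} → Unique xs → 2 ≤ length xs → ∃[ x ] ∃[ y ] x ∈ xs × y ∈ xs × x ≢ y
two-members {xs = _ ∷ []} _ (s≤s ())
two-members {xs = x ∷ y ∷ _} ((x≢y ∷ _) ∷ _) _ = x , y , here refl , there (here refl) , x≢y

-- Here c stands for ⌊2k / 6⌋ and m for 3(2k + c): k = 6 gives c = 2 and m = 42, k = 5 gives c = 1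
-- and m = 33.
link-≤ : ∀ {l b} k c m → b * 6 ≤ 2 * k → 2 * k < suc c * 6 → 6 * (2 * k + c) ≤ 2 * m →
         2 * l ≤ 6 * (2 * k + b) → l ≤ m
link-≤ {l} {b} k c m 6b≤ k< ≤2m 2l≤ = *-cancelˡ-≤ 2 (≤-trans 2l≤ (≤-trans
  (*-monoʳ-≤ 6 (+-monoʳ-≤ (2 * k) (s≤s⁻¹ (*-cancelʳ-< 6 b (suc c) (≤-<-trans 6b≤ k<))))) ≤2m))

-- With at most one nonzero term the bound is 33 itself. Otherwise the worst values are 12 + 12 =
-- 24, 1 + 12 + 12 = 25 and 12 + 8 + 8 = 28.
three-sum : ∀ p q r → p ≤ 33 → q ≤ 33 → r ≤ 33 →
            (1 ≤ p → q ≤ 12 × r ≤ 12) → (1 ≤ q → p ≤ 12 × r ≤ 12) → (1 ≤ r → p ≤ 12 × q ≤ 12) →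
            (2 ≤ p → q ≤ 8 × r ≤ 8) → p + q + r ≤ 33
three-sum 0 0 r p≤ q≤ r≤ fp fq fr gp = r≤
three-sum 0 (suc q) 0 p≤ q≤ r≤ fp fq fr gp = ≤-trans (≤-reflexive (+-identityʳ _)) q≤
three-sum 0 (suc q) (suc r) p≤ q≤ r≤ fp fq fr gp =
  ≤-trans (+-mono-≤ (proj₂ (fr (s≤s z≤n))) (proj₂ (fq (s≤s z≤n)))) (m≤m+n 24 9)
three-sum 1 q r p≤ q≤ r≤ fp fq fr gp =
  let q≤12 , r≤12 = fp ≤-refl in ≤-trans (s≤s (+-mono-≤ q≤12 r≤12)) (m≤m+n 25 8)
three-sum (suc (suc p)) 0 0 p≤ q≤ r≤ fp fq fr gp =
  ≤-trans (≤-reflexive (trans (+-identityʳ _) (+-identityʳ _))) p≤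
three-sum (suc (suc p)) 0 (suc r) p≤ q≤ r≤ fp fq fr gp =
  ≤-trans (+-mono-≤ (≤-trans (≤-reflexive (+-identityʳ _)) (proj₁ (fr (s≤s z≤n)))) (proj₂ (gp (s≤s (s≤s z≤n))))) (m≤m+n 20 13)
three-sum (suc (suc p)) (suc q) r p≤ q≤ r≤ fp fq fr gp =
  let q≤8 , r≤8 = gp (s≤s (s≤s z≤n))
  in ≤-trans (+-mono-≤ (+-mono-≤ (proj₁ (fq (s≤s z≤n))) q≤8) r≤8) (m≤m+n 28 5)

-- Counting around a maximum set of disjoint members.

module MaximumMatching {n : ℕ} {F : List (Subset n)} (free : SunflowerFree 3 7 F)
  {Ms : List (Subset n)} (matching : Petals ∅ Ms) (Ms⊆F : ∀ {A} → A ∈ Ms → A ∈ F)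
  (maximum : ∀ {Ns} → Petals ∅ Ns → (∀ {A} → A ∈ Ns → A ∈ F) → length Ns ≤ length Ms) where

  open SunflowerFree free
  open Family free

  private variable
    A B C : Subset n
    a b w x y : Fin n

  apart : A ∈ F → (∀ {w} → w ∈ˢ A → w ∉ˢ B) → A ≢ B × Meet ∅ A B
  apart {A} A∈ disj =
    let x , _ , _ , _ , x∈ , _ = triple {A = A} (size A∈)
    in (λ { refl → disj x∈ x∈ }) , λ w∈A w∈B → contradiction w∈B (disj w∈A)

  disjoint-∷ : ∀ {Ns} → A ∈ F → (∀ {B w} → B ∈ Ns → w ∈ˢ A → w ∉ˢ B) → Petals ∅ Ns → Petals ∅ (A ∷ Ns)
  disjoint-∷ A∈ disj = petals-∷ (λ w∈ → contradiction w∈ ∉⊥) (λ B∈ → apart A∈ (disj B∈))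

  same-block : A ∈ Ms → B ∈ Ms → w ∈ˢ A → w ∈ˢ B → A ≡ B
  same-block {A} {B} A∈ B∈ w∈A w∈B =
    decidable-stable (A ≟ˢ B) λ A≢B → ∉⊥ (Petals.meet matching A∈ B∈ A≢B w∈A w∈B)

  V : Fin n → Set
  V x = Any (x ∈ˢ_) Ms

  V? : Decidable V
  V? x = anyᴸ? (x ∈?_) Ms

  hits : A ∈ F → ∃[ x ] x ∈ˢ A × V x
  hits {A} A∈ with any? (λ x → (x ∈? A) ×-dec V? x)
  ... | yes hit = hit
  ... | no none = contradiction
    (maximum (disjoint-∷ A∈ (λ B∈ w∈A w∈B → none (_ , w∈A , lose B∈ w∈B)) matching)
             (λ { (here refl) → A∈ ; (there B∈) → Ms⊆F B∈ }))
    (<⇒≱ ≤-refl)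

  Only : Fin n → Subset n → Set
  Only x A = x ∈ˢ A × (∀ y → y ∈ˢ A → V y → y ≡ x)

  only? : ∀ x → Decidable (Only x)
  only? x A = (x ∈? A) ×-dec all? (λ y → (y ∈? A) →-dec V? y →-dec (y ≟ᶠ x))

  through private-at : Fin n → List (Subset n)
  through    x = filter (x ∈?_) F
  private-at x = filter (only? x) F

  private-unique : Unique (private-at a)
  private-unique {a} = filter⁺ (only? a) unique

  private⊆F : A ∈ private-at a → A ∈ F
  private⊆F {a = a} A∈ = proj₁ (∈-filter⁻ (only? a) A∈)

  private-only : A ∈ private-at a → ∀ {y} → y ∈ˢ A → V y → y ≡ a
  private-only {a = a} A∈ {y} = proj₂ (proj₂ (∈-filter⁻ (only? a) {xs = F} A∈)) y

  private∋ : A ∈ private-at a → a ∈ˢ A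
  private∋ {a = a} A∈ = proj₁ (proj₂ (∈-filter⁻ (only? a) {xs = F} A∈))

  through≤42 : ∀ x → length (through x) ≤ 42
  through≤42 x =
    let b , 6b≤ , ≤b = length-bound 6 λ P ⊆G → few-petals P (λ A∈ → proj₁ (∈-filter⁻ (x ∈?_) {xs = F} (⊆G A∈)))
    in link-≤ 6 2 42 6b≤ (m≤m+n 13 5) ≤-refl ≤b
    where
    open Link {x} (filter⁺ (x ∈?_) unique) (λ A∈ → proj₁ (∈-filter⁻ (x ∈?_) A∈))
                  (λ A∈ → proj₂ (∈-filter⁻ (x ∈?_) {xs = F} A∈))

  -- The block of the matching through x is a further petal.
  private≤33 : B ∈ Ms → x ∈ˢ B → length (private-at x) ≤ 33
  private≤33 {B} {x} B∈ x∈B =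
    let b , 6b≤ , ≤b = length-bound 5 few in link-≤ 5 1 33 6b≤ (m≤m+n 11 1) ≤-refl ≤b
    where
    open Link {x} private-unique private⊆F private∋
    few : ∀ {As} → Petals ⁅ x ⁆ As → (∀ {A} → A ∈ As → A ∈ private-at x) → length As ≤ 5
    few {As} P As⊆ = s≤s⁻¹ (few-petals
      (petals-∷ (λ w∈ → subst (_∈ˢ B) (sym (x∈⁅y⁆⇒x≡y x w∈)) x∈B) away P)
      (λ { (here refl) → Ms⊆F B∈ ; (there A∈) → private⊆F (As⊆ A∈) }))
      where
      away : ∀ {A} → A ∈ As → B ≢ A × Meet ⁅ x ⁆ B A
      away A∈ =
        let p , _ , (x≢p , _) , p∈ , _ = two-others {A = B} (size (Ms⊆F B∈)) x∈B
            at-x = λ {w} w∈B w∈A → private-only (As⊆ A∈) {w} w∈A (lose B∈ w∈B)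
        in (λ { refl → x≢p (sym (at-x p∈ p∈)) })
         , λ w∈B w∈A → subst (_∈ˢ ⁅ x ⁆) (sym (at-x w∈B w∈A)) (x∈⁅x⁆ x)

  -- Otherwise replacing the block by the two disjoint sets enlarges the matching.
  crossing : B ∈ Ms → a ∈ˢ B → b ∈ˢ B → a ≢ b → A ∈ private-at a → C ∈ private-at b →
             ∃[ w ] w ∈ˢ A × w ∈ˢ C
  crossing {B} {a} {b} {A} {C} B∈ a∈B b∈B a≢b A∈ C∈ with any? (λ w → (w ∈? A) ×-dec (w ∈? C))
  ... | yes common = common
  ... | no none = contradiction
    -- Every member of the matching is B or one of `others`, so the new family, with two sets in
    -- place of B, is strictly longer.
    (≤-trans (maximum larger larger⊆F) (length-⊆ _≟ˢ_ {ys = B ∷ others} (Petals.distinct matching) covered-by))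
    (<⇒≱ ≤-refl)
    where
    ≢B? : Decidable (_≢ B)
    ≢B? D = ¬? (D ≟ˢ B)
    others : List (Subset n)
    others = filter ≢B? Ms
    covered-by : ∀ {D} → D ∈ Ms → D ∈ B ∷ others
    covered-by {D} D∈ with D ≟ˢ B
    ... | yes refl = here refl
    ... | no D≢B = there (∈-filter⁺ ≢B? D∈ D≢B)
    avoids : ∀ {e H D w} → e ∈ˢ B → H ∈ private-at e → D ∈ others → w ∈ˢ H → w ∉ˢ D
    avoids e∈B H∈ D∈ w∈H w∈D =
      let D∈Ms , D≢B = ∈-filter⁻ ≢B? D∈
      in D≢B (same-block D∈Ms B∈ (subst (_∈ˢ _) (private-only H∈ w∈H (lose D∈Ms w∈D)) w∈D) e∈B)
    larger : Petals ∅ (A ∷ C ∷ others)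
    larger = disjoint-∷ (private⊆F A∈)
      (λ { (here refl) w∈A w∈C → none (_ , w∈A , w∈C) ; (there D∈) → avoids a∈B A∈ D∈ })
      (disjoint-∷ (private⊆F C∈) (avoids b∈B C∈) (petals-filter ≢B? matching))
    larger⊆F : ∀ {D} → D ∈ A ∷ C ∷ others → D ∈ F
    larger⊆F (here refl) = private⊆F A∈
    larger⊆F (there (here refl)) = private⊆F C∈
    larger⊆F (there (there D∈)) = Ms⊆F (proj₁ (∈-filter⁻ ≢B? D∈))

  module Cross (B∈ : B ∈ Ms) {a b : Fin n} (a∈B : a ∈ˢ B) (b∈B : b ∈ˢ B) (a≢b : a ≢ b) where

    -- The common point of A and C cannot be a, since C meets V only in b; so it is one of the other
    -- two points of A.
    ∋-private : ∀ {A C x y} → A ∈ private-at a → a ≢ x → a ≢ y → x ≢ y → x ∈ˢ A → y ∈ˢ A →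
                C ∈ private-at b → x ∈ˢ C ⊎ y ∈ˢ C
    ∋-private {A} {C} A∈ a≢x a≢y x≢y x∈ y∈ C∈ with crossing B∈ a∈B b∈B a≢b A∈ C∈
    ... | w , w∈A , w∈C with no-fourth {A = A} (size (private⊆F A∈)) a≢x a≢y x≢y (private∋ A∈) x∈ y∈ w∈A
    ...   | inj₁ refl = contradiction (private-only C∈ w∈C (lose B∈ a∈B)) a≢b
    ...   | inj₂ (inj₁ refl) = inj₁ w∈C
    ...   | inj₂ (inj₂ refl) = inj₂ w∈C

    b≢ : ∀ {A x} → A ∈ private-at a → x ∈ˢ A → b ≢ x
    b≢ A∈ x∈ refl = a≢b (sym (private-only A∈ x∈ (lose B∈ b∈B)))

    star≤6 : ∀ x → b ≢ x → length (filter (x ∈?_) (private-at b)) ≤ 6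
    star≤6 x b≢x = pair-degree (filter⁺ (x ∈?_) private-unique)
      (λ C∈ → private⊆F (proj₁ (∈-filter⁻ (x ∈?_) C∈))) b≢x
      (λ C∈ → let C∈b , x∈C = ∈-filter⁻ (x ∈?_) {xs = private-at b} C∈ in private∋ C∈b , x∈C)

    -- Every set at b contains b and one of the two outer points of a fixed set at a; each such pair
    -- lies in at most 6 members.
    private≤12 : 1 ≤ length (private-at a) → length (private-at b) ≤ 12
    private≤12 nonempty =
      let A , A∈ = member (private-at a) nonempty
          x , y , (a≢x , a≢y , x≢y) , x∈ , y∈ = two-others {A = A} (size (private⊆F A∈)) (private∋ A∈)
      in ≤-trans (length-cover (x ∈?_) (y ∈?_) (private-at b) (∋-private A∈ a≢x a≢y x≢y x∈ y∈))
                 (+-mono-≤ (star≤6 x (b≢ A∈ x∈)) (star≤6 y (b≢ A∈ y∈)))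

    both? : ∀ (x y : Fin n) → Decidable (λ C → x ∈ˢ C × y ∈ˢ C)
    both? x y C = (x ∈? C) ×-dec (y ∈? C)

    both≤1 : ∀ x y → b ≢ x → b ≢ y → x ≢ y → length (filter (both? x y) (private-at b)) ≤ 1
    both≤1 x y b≢x b≢y x≢y = ≤-trans (≤-reflexive (length-filter (both? x y) (private-at b)))
      (∑-𝟙≤1 (both? x y) private-unique λ {C} {D} C∈ D∈ (x∈C , y∈C) (x∈D , y∈D) →
        triple-≡ {A = C} {D} (size (private⊆F C∈)) (size (private⊆F D∈)) b≢x b≢y x≢y
          (private∋ C∈) x∈C y∈C (private∋ D∈) x∈D y∈D)

    -- Two different triples through a differ in an outer point, say y ∈ A outside A′. Then 8 = 6 +
    -- 1 + 1: at most 6 sets at b contain the other outer point of A, and the rest contain y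
    -- together with one of two points of A′, which determines them.
    private≤8 : 2 ≤ length (private-at a) → length (private-at b) ≤ 8
    private≤8 several with two-members private-unique several
    ... | A , A′ , A∈ , A′∈ , A≢A′
      with two-others {A = A} (size (private⊆F A∈)) (private∋ A∈)
         | two-others {A = A′} (size (private⊆F A′∈)) (private∋ A′∈)
    ... | x , y , (a≢x , a≢y , x≢y) , x∈ , y∈ | p , q , (a≢p , a≢q , p≢q) , p∈ , q∈ = split (x ∈? A′) (y ∈? A′)
      where
      -- Each C ∌ x contains y and meets A′, which does not contain y.
      bound : ∀ {x y} → a ≢ x → a ≢ y → x ≢ y → x ∈ˢ A → y ∈ˢ A → y ∉ˢ A′ → length (private-at b) ≤ 8
      bound {x} {y} a≢x a≢y x≢y x∈ y∈ y∉ = ≤-trans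
        (length-cover (x ∈?_) y∈pq? (private-at b) cover)
        (+-mono-≤ (star≤6 x (b≢ A∈ x∈)) (≤-trans
          (length-cover (both? y p) (both? y q) (filter y∈pq? (private-at b))
            (λ C∈ → proj₂ (∈-filter⁻ y∈pq? {xs = private-at b} C∈)))
          (+-mono-≤ (once p (b≢ A′∈ p∈) (λ { refl → y∉ p∈ })) (once q (b≢ A′∈ q∈) (λ { refl → y∉ q∈ })))))
        where
        y∈pq? : Decidable (λ (C : Subset n) → (y ∈ˢ C × p ∈ˢ C) ⊎ (y ∈ˢ C × q ∈ˢ C))
        y∈pq? C = both? y p C ⊎-dec both? y q C
        cover : ∀ {C} → C ∈ private-at b → x ∈ˢ C ⊎ ((y ∈ˢ C × p ∈ˢ C) ⊎ (y ∈ˢ C × q ∈ˢ C))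
        cover C∈ with ∋-private A∈ a≢x a≢y x≢y x∈ y∈ C∈ | ∋-private A′∈ a≢p a≢q p≢q p∈ q∈ C∈
        ... | inj₁ x∈C | _ = inj₁ x∈C
        ... | inj₂ y∈C | inj₁ p∈C = inj₂ (inj₁ (y∈C , p∈C))
        ... | inj₂ y∈C | inj₂ q∈C = inj₂ (inj₂ (y∈C , q∈C))
        once : ∀ t → b ≢ t → y ≢ t → length (filter (both? y t) (filter y∈pq? (private-at b))) ≤ 1
        once t b≢t y≢t = ≤-trans
          (length-⊆ _≟ˢ_ (filter⁺ (both? y t) (filter⁺ y∈pq? private-unique))
            (λ C∈ → let C∈′ , yt∈ = ∈-filter⁻ (both? y t) {xs = filter y∈pq? (private-at b)} C∈
                    in ∈-filter⁺ (both? y t) (proj₁ (∈-filter⁻ y∈pq? {xs = private-at b} C∈′)) yt∈))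
          (both≤1 y t (b≢ A∈ y∈) b≢t y≢t)
      split : Dec (x ∈ˢ A′) → Dec (y ∈ˢ A′) → length (private-at b) ≤ 8
      split _ (no y∉) = bound a≢x a≢y x≢y x∈ y∈ y∉
      split (no x∉) (yes _) = bound a≢y a≢x (≢-sym x≢y) y∈ x∈ x∉
      split (yes x∈′) (yes y∈′) = contradiction
        (triple-≡ {A = A} {A′} (size (private⊆F A∈)) (size (private⊆F A′∈)) a≢x a≢y x≢y
          (private∋ A∈) x∈ y∈ (private∋ A′∈) x∈′ y∈′) A≢A′

  weight : Fin n → ℕ
  weight x = length (through x) + length (private-at x)

  block-weight : B ∈ Ms → ∑[ x ∈ allFin n ] (weight x * 𝟙 (x ∈? B)) ≤ 159
  block-weight {B} B∈ with triple {A = B} (size (Ms⊆F B∈))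
  ... | a , b , c , (a≢b , a≢c , b≢c) , a∈ , b∈ , c∈ = begin
    ∑[ x ∈ allFin n ] (weight x * 𝟙 (x ∈? B))
      ≤⟨ ∑-mono (allFin n) (λ {x} _ → pointwise x (x ∈? B)) ⟩
    ∑[ x ∈ allFin n ] (𝟙 (a ≟ᶠ x) * weight a + 𝟙 (b ≟ᶠ x) * weight b + 𝟙 (c ≟ᶠ x) * weight c)
      ≡⟨ trans (∑-distrib-+ (allFin n) _ _) (cong₂ _+_ (∑-distrib-+ (allFin n) _ _) refl) ⟩
    ∑[ x ∈ allFin n ] (𝟙 (a ≟ᶠ x) * weight a) + ∑[ x ∈ allFin n ] (𝟙 (b ≟ᶠ x) * weight b) +
      ∑[ x ∈ allFin n ] (𝟙 (c ≟ᶠ x) * weight c)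
      ≡⟨ cong₂ _+_ (cong₂ _+_ (point a) (point b)) (point c) ⟩
    weight a + weight b + weight c
      ≡⟨ rearrange (length (through a)) (length (private-at a)) _ _ (length (through c)) _ ⟩
    (length (through a) + length (through b) + length (through c)) +
      (length (private-at a) + length (private-at b) + length (private-at c))
      ≤⟨ +-mono-≤ (+-mono-≤ (+-mono-≤ (through≤42 a) (through≤42 b)) (through≤42 c))
           (three-sum _ _ _ (private≤33 B∈ a∈) (private≤33 B∈ b∈) (private≤33 B∈ c∈)
             (λ h → Cross.private≤12 B∈ a∈ b∈ a≢b h , Cross.private≤12 B∈ a∈ c∈ a≢c h)
             (λ h → Cross.private≤12 B∈ b∈ a∈ (≢-sym a≢b) h , Cross.private≤12 B∈ b∈ c∈ b≢c h)
             (λ h → Cross.private≤12 B∈ c∈ a∈ (≢-sym a≢c) h , Cross.private≤12 B∈ c∈ b∈ (≢-sym b≢c) h)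
             (λ h → Cross.private≤8 B∈ a∈ b∈ a≢b h , Cross.private≤8 B∈ a∈ c∈ a≢c h)) ⟩
    159 ∎
    where
    open ≤-Reasoning
    rearrange : ∀ p q r s t u → (p + q) + (r + s) + (t + u) ≡ (p + r + t) + (q + s + u)
    rearrange = solve-∀
    point : ∀ e → ∑[ x ∈ allFin n ] (𝟙 (e ≟ᶠ x) * weight e) ≡ weight e
    point e = trans (∑-distribʳ-* (allFin n) _ (weight e)) (trans (cong (_* weight e) (δᶠ e)) (*-identityˡ _))
    pointwise : ∀ x → (d : Dec (x ∈ˢ B)) → weight x * 𝟙 d ≤
      𝟙 (a ≟ᶠ x) * weight a + 𝟙 (b ≟ᶠ x) * weight b + 𝟙 (c ≟ᶠ x) * weight c
    pointwise x (no _) = ≤-trans (≤-reflexive (*-zeroʳ (weight x))) z≤n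
    pointwise x (yes x∈) = ≤-trans (≤-reflexive (*-identityʳ (weight x)))
      (at (no-fourth {A = B} (size (Ms⊆F B∈)) a≢b a≢c b≢c a∈ b∈ c∈ x∈))
      where
      self : ∀ e → weight e ≤ 𝟙 (e ≟ᶠ e) * weight e
      self e = ≤-reflexive (sym (trans (cong (_* weight e) (𝟙-yes (e ≟ᶠ e) refl)) (*-identityˡ _)))
      at : ∀ {x} → x ≡ a ⊎ x ≡ b ⊎ x ≡ c → weight x ≤
        𝟙 (a ≟ᶠ x) * weight a + 𝟙 (b ≟ᶠ x) * weight b + 𝟙 (c ≟ᶠ x) * weight c
      at (inj₁ refl) = ≤-trans (self a) (≤-trans (m≤m+n _ _) (m≤m+n _ _))
      at (inj₂ (inj₁ refl)) = ≤-trans (self b) (≤-trans (m≤n+m _ (𝟙 (a ≟ᶠ b) * weight a)) (m≤m+n _ _))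
      at (inj₂ (inj₂ refl)) = ≤-trans (self c) (m≤n+m _ (𝟙 (a ≟ᶠ c) * weight a + 𝟙 (b ≟ᶠ c) * weight b))

  inBlock? : ∀ A → Decidable (λ x → x ∈ˢ A × V x)
  inBlock? A x = (x ∈? A) ×-dec V? x

  onlyBlock? : ∀ A → Decidable (λ x → Only x A × V x)
  onlyBlock? A x = only? x A ×-dec V? x

  matched? : Decidable (_∈ Ms)
  matched? A = anyᴸ? (A ≟ˢ_) Ms

  meeting : Subset n → ℕ
  meeting A = ∑[ x ∈ allFin n ] (𝟙 (inBlock? A x) + 𝟙 (onlyBlock? A x))

  -- A matched set has all three points in V. Any other set has at least one, and if there is no
  -- second, the only one is counted again by `onlyBlock?`.
  meeting-≥ : A ∈ F → 2 + 𝟙 (matched? A) ≤ meeting A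
  meeting-≥ {A} A∈ = ≤-trans (cases (matched? A)) (≤-reflexive (sym (∑-distrib-+ (allFin n) _ _)))
    where
    cases : (d : Dec (A ∈ Ms)) →
            2 + 𝟙 d ≤ ∑[ x ∈ allFin n ] 𝟙 (inBlock? A x) + ∑[ x ∈ allFin n ] 𝟙 (onlyBlock? A x)
    cases (yes A∈Ms) with triple {A = A} (size A∈)
    ... | p , q , r , (p≢q , p≢r , q≢r) , p∈ , q∈ , r∈ = ≤-trans
      (count-≥ _≟ᶠ_ (inBlock? A) {ys = p ∷ q ∷ r ∷ []} ((p≢q ∷ p≢r ∷ []) ∷ (q≢r ∷ []) ∷ [] ∷ [])
        λ { (here refl) → ∈-allFin p , p∈ , lose A∈Ms p∈
          ; (there (here refl)) → ∈-allFin q , q∈ , lose A∈Ms q∈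
          ; (there (there (here refl))) → ∈-allFin r , r∈ , lose A∈Ms r∈ })
      (m≤m+n _ _)
    cases (no _) with hits A∈
    ... | x , x∈ , Vx with any? (λ y → inBlock? A y ×-dec ¬? (y ≟ᶠ x))
    ...   | yes (y , (y∈ , Vy) , y≢x) = ≤-trans
      (count-≥ _≟ᶠ_ (inBlock? A) {ys = y ∷ x ∷ []} ((y≢x ∷ []) ∷ [] ∷ [])
        λ { (here refl) → ∈-allFin y , y∈ , Vy ; (there (here refl)) → ∈-allFin x , x∈ , Vx })
      (m≤m+n _ _)
    ...   | no none = +-mono-≤
      (count-≥ _≟ᶠ_ (inBlock? A) {ys = x ∷ []} ([] ∷ []) λ { (here refl) → ∈-allFin x , x∈ , Vx })
      (count-≥ _≟ᶠ_ (onlyBlock? A) {ys = x ∷ []} ([] ∷ []) λ { (here refl) → ∈-allFin x , only , Vx })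
      where
      only : Only x A
      only = x∈ , λ y y∈ Vy → decidable-stable (y ≟ᶠ x) λ y≢x → none (y , (y∈ , Vy) , y≢x)

  -- A point of V lies in some block, so its contribution can be charged to that block; this
  -- prepares the sum for regrouping block by block.
  meeting-≤ : ∀ A → meeting A ≤ ∑[ x ∈ allFin n ] ∑[ B ∈ Ms ] ((𝟙 (x ∈? A) + 𝟙 (only? x A)) * 𝟙 (x ∈? B))
  meeting-≤ A = ∑-mono (allFin n) λ {x} _ → row x (V? x)
    where
    row : ∀ x → Dec (V x) → 𝟙 (inBlock? A x) + 𝟙 (onlyBlock? A x) ≤
                            ∑[ B ∈ Ms ] ((𝟙 (x ∈? A) + 𝟙 (only? x A)) * 𝟙 (x ∈? B))
    row x (no ¬Vx) rewrite 𝟙-no (inBlock? A x) (¬Vx ∘ proj₂) | 𝟙-no (onlyBlock? A x) (¬Vx ∘ proj₂) = z≤n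
    row x (yes Vx) =
      let B , B∈ , x∈B = find Vx
          s = 𝟙 (x ∈? A) + 𝟙 (only? x A)
      in ≤-trans (+-mono-≤ (𝟙-mono (inBlock? A x) (x ∈? A) proj₁) (𝟙-mono (onlyBlock? A x) (only? x A) proj₁))
        (≤-trans (≤-reflexive (trans (sym (*-identityʳ s)) (cong (s *_) (sym (𝟙-yes (x ∈? B) x∈B)))))
                 (∑-∈ (λ B → s * 𝟙 (x ∈? B)) B∈))

  meeting-sum : ∑ F meeting ≤ length Ms * 159
  meeting-sum = begin
    ∑ F meeting
      ≤⟨ ∑-mono F (λ {A} _ → meeting-≤ A) ⟩
    ∑[ A ∈ F ] ∑[ x ∈ allFin n ] ∑[ B ∈ Ms ] ((𝟙 (x ∈? A) + 𝟙 (only? x A)) * 𝟙 (x ∈? B))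
      ≡⟨ ∑-cong F (λ A → ∑-swap (allFin n) Ms _) ⟩
    ∑[ A ∈ F ] ∑[ B ∈ Ms ] ∑[ x ∈ allFin n ] ((𝟙 (x ∈? A) + 𝟙 (only? x A)) * 𝟙 (x ∈? B))
      ≡⟨ ∑-swap F Ms _ ⟩
    ∑[ B ∈ Ms ] ∑[ A ∈ F ] ∑[ x ∈ allFin n ] ((𝟙 (x ∈? A) + 𝟙 (only? x A)) * 𝟙 (x ∈? B))
      ≡⟨ ∑-cong Ms (λ B → trans (∑-swap F (allFin n) _) (∑-cong (allFin n) (λ x → column x B))) ⟩
    ∑[ B ∈ Ms ] ∑[ x ∈ allFin n ] (weight x * 𝟙 (x ∈? B))
      ≤⟨ ∑-mono Ms block-weight ⟩
    ∑[ B ∈ Ms ] 159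
      ≡⟨ ∑-const Ms 159 ⟩
    length Ms * 159 ∎
    where
    open ≤-Reasoning
    column : ∀ x B → ∑[ A ∈ F ] ((𝟙 (x ∈? A) + 𝟙 (only? x A)) * 𝟙 (x ∈? B)) ≡ weight x * 𝟙 (x ∈? B)
    column x B = trans (∑-distribʳ-* F _ (𝟙 (x ∈? B))) (cong (_* 𝟙 (x ∈? B)) (trans (∑-distrib-+ F _ _)
      (sym (cong₂ _+_ (length-filter (x ∈?_) F) (length-filter (only? x) F)))))

  length≤79* : length F ≤ length Ms * 79
  length≤79* = *-cancelʳ-≤ (length F) (length Ms * 79) 2 (+-cancelʳ-≤ (length Ms) _ _ (begin
    length F * 2 + length Ms
      ≤⟨ +-mono-≤ (≤-reflexive (sym (∑-const F 2)))
           (count-≥ _≟ˢ_ matched? (Petals.distinct matching) λ A∈ → Ms⊆F A∈ , A∈) ⟩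
    ∑[ A ∈ F ] 2 + ∑[ A ∈ F ] 𝟙 (matched? A)
      ≡⟨ sym (∑-distrib-+ F _ _) ⟩
    ∑[ A ∈ F ] (2 + 𝟙 (matched? A))
      ≤⟨ ∑-mono F meeting-≥ ⟩
    ∑ F meeting
      ≤⟨ meeting-sum ⟩
    length Ms * 159
      ≡⟨ arith (length Ms) ⟩
    length Ms * 79 * 2 + length Ms ∎))
    where
    open ≤-Reasoning
    arith : ∀ m → m * 159 ≡ m * 79 * 2 + m
    arith = solve-∀

-- A matching with no larger one would bound F, so every matching of size j
-- yields one of size j + 1, up to the forbidden size 7.
upper-bound : ∀ {n} {F : List (Subset n)} → SunflowerFree 3 7 F → length F ≤ 474
-- The goal is decidable, so one may argue by contradiction and need not construct a maximum
-- matching. The counter starts at 7 with the empty matching and falls with each enlargement.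
upper-bound {n} {F} free = decidable-stable (length F ≤? 474) λ large → none large 7 petals-[] (λ ()) ≤-refl
  where
  open Family free
  none : ¬ (length F ≤ 474) → ∀ d {Ms} → Petals ∅ Ms → (∀ {A} → A ∈ Ms → A ∈ F) → ¬ (7 ≤ d + length Ms)
  none large zero    P Ms⊆F 7≤ = <⇒≱ 7≤ (few-petals P Ms⊆F)
  none large (suc d) {Ms} P Ms⊆F 7≤ = large (≤-trans
    (MaximumMatching.length≤79* free P Ms⊆F λ {Ns} Q Ns⊆F → ≮⇒≥ λ larger →
      none large d Q Ns⊆F (≤-trans 7≤ (≤-trans (≤-reflexive (sym (+-suc d (length Ms)))) (+-monoʳ-≤ d larger))))
    (*-monoˡ-≤ 79 (few-petals P Ms⊆F)))

-- Deciding which sizes are attained on a fixed ground set.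

module _ {n : ℕ} where

  isSunflower? : ∀ {k} → Decidable (IsSunflower {n} {k})
  isSunflower? A = map′
    (λ (inj , C , meet) → record { distinct = λ {i} {j} → inj i j ; core = C ; meet = λ {i} {j} → meet i j })
    (λ S → let open IsSunflower S in (λ _ _ → distinct) , core , λ _ _ → meet)
    (all? (λ i → all? λ j → (A i ≟ˢ A j) →-dec (i ≟ᶠ j)) ×-dec
     anySubset? λ C → all? λ i → all? λ j → ¬? (i ≟ᶠ j) →-dec (A i ∩ A j ≟ˢ C))

  IsSunflower-cong : ∀ {k} {A B : Fin k → Subset n} → A ≗ B → IsSunflower A → IsSunflower B
  IsSunflower-cong eq S = record
    { distinct = λ {i} {j} Bi≡Bj → distinct (trans (eq i) (trans Bi≡Bj (sym (eq j))))
    ; core     = core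
    ; meet     = λ {i} {j} i≢j → trans (sym (cong₂ _∩_ (eq i) (eq j))) (meet i≢j)
    }
    where open IsSunflower S

  containsSunflower? : ∀ k → Decidable (ContainsSunflower {n} k)
  containsSunflower? k F = map′
    (λ (As , good) → lookup As , good)
    (λ (A , S , A∈) → let eq = sym ∘ lookup∘tabulate A in
      tabulateᵛ A , IsSunflower-cong eq S , λ i → subst (_∈ F) (eq i) (A∈ i))
    (searchVec anySubset? k λ As → isSunflower? (lookup As) ×-dec all? λ i → anyᴸ? (lookup As i ≟ˢ_) F)

  sunflowerFree? : ∀ w k → Decidable (SunflowerFree w k {n})
  sunflowerFree? w k F = map′
    (λ (u , s , f) → record { unique = u ; uniform = s ; noSunflower = f })
    (λ free → let open SunflowerFree free in unique , uniform , noSunflower)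
    (unique? _≟ˢ_ F ×-dec All.all? (λ A → ∣ A ∣ ≟ w) F ×-dec ¬? (containsSunflower? k F))

  attained? : ∀ w k m → Dec (∃[ F ] SunflowerFree w k {n} F × length F ≡ m)
  attained? w k m = map′
    (λ (As , free) → toList As , free , length-toList As)
    (λ { (F , free , refl) → fromList F , subst (SunflowerFree w k) (sym (toList∘fromList F)) free })
    (searchVec anySubset? m λ As → sunflowerFree? w k (toList As))

-- Shrinking the ground set and existence of the maximum.

embed : ∀ {n} → Fin (suc n) → Subset n → Subset (suc n)
embed x s = insertAt s x outside

embed-injective : ∀ {n} (x : Fin (suc n)) {s t : Subset n} → embed x s ≡ embed x t → s ≡ t
embed-injective x {s} {t} eq =
  trans (sym (removeAt-insertAt s x outside)) (trans (cong (λ r → removeAt r x) eq) (removeAt-insertAt t x outside))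

∣embed∣ : ∀ {n} (x : Fin (suc n)) (s : Subset n) → ∣ embed x s ∣ ≡ ∣ s ∣
∣embed∣ zero s = refl
∣embed∣ (suc x) (outside ∷ s) = ∣embed∣ x s
∣embed∣ (suc x) (inside ∷ s) = cong suc (∣embed∣ x s)

embed-∩ : ∀ {n} (x : Fin (suc n)) (s t : Subset n) → embed x s ∩ embed x t ≡ embed x (s ∩ t)
embed-∩ zero s t = refl
embed-∩ (suc x) (a ∷ s) (b ∷ t) = cong (_ ∷_) (embed-∩ x s t)

embed-removeAt : ∀ {n} (x : Fin (suc n)) {s : Subset (suc n)} → x ∉ˢ s → embed x (removeAt s x) ≡ s
embed-removeAt x {s} x∉ = trans (cong (insertAt (removeAt s x) x) (sym outside-x)) (insertAt-removeAt s x)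
  where
  outside-x : lookup s x ≡ outside
  outside-x with lookup s x in eq
  ... | inside  = contradiction (lookup⇒[]= x s eq) x∉
  ... | outside = refl

-- Inserting an outside point is injective and commutes with intersection, so a sunflower in the
-- small family would embed into the large one.
unembed-free : ∀ {w k n} (x : Fin (suc n)) {F : List (Subset n)} →
               SunflowerFree w k (map (embed x) F) → SunflowerFree w k F
unembed-free x {F} free = record
  { unique      = Unique-map⁻ unique
  ; uniform     = All.map (λ {A} eq → trans (sym (∣embed∣ x A)) eq) (All-map⁻ uniform)
  ; noSunflower = λ (A , S , A∈) → let open IsSunflower S in noSunflower
      ( embed x ∘ A
      , record { distinct = λ eq → distinct (embed-injective x eq)
               ; core = embed x core
               ; meet = λ {i} {j} i≢j → trans (embed-∩ x (A i) (A j)) (cong (embed x) (meet i≢j)) }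
      , λ i → ∈-map⁺ (embed x) (A∈ i))
  }
  where open SunflowerFree free

-- If every point were used, the incidences, of which there are `length F * w`, would number at
-- least n.
unused-point : ∀ {w n} {F : List (Subset n)} → All (λ A → ∣ A ∣ ≡ w) F → length F * w < n →
               ∃[ x ] All (x ∉ˢ_) F
unused-point {w} {n} {F} uniform small with any? (λ x → All.all? (λ A → ¬? (x ∈? A)) F)
... | yes unused = unused
... | no none = contradiction small (≤⇒≯ (begin
  n
    ≡⟨ sym (trans (∑-const (allFin n) 1) (trans (*-identityʳ _) (length-tabulate id))) ⟩
  ∑[ x ∈ allFin n ] 1
    ≤⟨ ∑-mono (allFin n) (λ {x} _ → used x) ⟩
  ∑[ x ∈ allFin n ] ∑[ A ∈ F ] 𝟙 (x ∈? A)
    ≡⟨ ∑-swap (allFin n) F _ ⟩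
  ∑[ A ∈ F ] ∑[ x ∈ allFin n ] 𝟙 (x ∈? A)
    ≤⟨ ∑-mono F (λ {A} A∈ → ≤-reflexive (trans (sym (∣∣≡∑ A)) (All.lookup uniform A∈))) ⟩
  ∑[ A ∈ F ] w
    ≡⟨ ∑-const F w ⟩
  length F * w ∎))
  where
  open ≤-Reasoning
  used : ∀ x → 1 ≤ ∑[ A ∈ F ] 𝟙 (x ∈? A)
  used x with anyᴸ? (x ∈?_) F
  ... | yes x∈F = let A , A∈ , x∈ = find x∈F in
    ≤-trans (≤-reflexive (sym (𝟙-yes (x ∈? A) x∈))) (∑-∈ (λ A → 𝟙 (x ∈? A)) A∈)
  ... | no x∉F = contradiction (x , ¬Any⇒All¬ F x∉F) none

shrink : ∀ {w k} n (F : List (Subset n)) → SunflowerFree w k F →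
         ∃[ n′ ] n′ ≤ length F * w × ∃[ F′ ] SunflowerFree w k {n′} F′ × length F′ ≡ length F
shrink {w} {k} n F free with n ≤? length F * w
... | yes small = n , small , F , free , refl
shrink zero F free | no large = contradiction z≤n large
shrink {w} {k} (suc n) F free | no large =
  let x , x∉ = unused-point (SunflowerFree.uniform free) (≰⇒> large)
      F₁ = map (λ A → removeAt A x) F
      F≡ = trans (sym (map-∘ F)) (map-id-local (All.map (embed-removeAt x) x∉))
      n′ , n′≤ , F′ , free′ , len = shrink n F₁ (unembed-free x (subst (SunflowerFree w k) (sym F≡) free))
      len₁ = length-map (λ A → removeAt A x) F
  in n′ , ≤-trans n′≤ (≤-reflexive (cong (_* w) len₁)) , F′ , free′ , trans len len₁

greatest : ∀ {P : ℕ → Set} → Decidable P → ∀ {m₀} → P m₀ → ∀ b → (∀ {m} → P m → m ≤ b) →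
           ∃[ m ] P m × (∀ {m′} → P m′ → m′ ≤ m)
greatest P? p₀ b bound with P? b
... | yes p = b , p , bound
greatest {P} P? p₀ zero bound | no ¬p = contradiction (subst P (n≤0⇒n≡0 (bound p₀)) p₀) ¬p
greatest {P} P? p₀ (suc b) bound | no ¬p =
  greatest P? p₀ b λ p → s≤s⁻¹ (≤∧≢⇒< (bound p) λ { refl → ¬p p })

-- The maximum exists constructively because b sets of size w can be moved to
-- a ground set of at most b * w points, which leaves a finite search.
maximum-exists : ∀ {w k} b → (∀ {n} (F : List (Subset n)) → SunflowerFree w k F → length F ≤ b) →
                 ∀ {n l} {F : List (Subset n)} → SunflowerFree w k F → l ≤ length F →
                 ∃[ m ] Isf w k m × l ≤ m × m ≤ b
maximum-exists {w} {k} b upper {F = F} free l≤ =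
  let m , (i , F′ , free′ , len) , bound = greatest attainable? (attain F free) b λ { (_ , F′ , free′ , refl) → upper F′ free′ }
  in m , record { attained = toℕ i , F′ , free′ , len ; bound = λ G free″ → bound (attain G free″) }
       , ≤-trans l≤ (bound (attain F free)) , ≤-trans (≤-reflexive (sym len)) (upper F′ free′)
  where
  Attainable : ℕ → Set
  Attainable m = ∃[ i ] ∃[ F ] SunflowerFree w k {toℕ {suc (b * w)} i} F × length F ≡ m
  attainable? : Decidable Attainable
  attainable? m = any? λ i → attained? w k m
  attain : ∀ {n} (G : List (Subset n)) → SunflowerFree w k G → Attainable (length G)
  attain {n} G free″ =
    let n′ , n′≤ , G′ , free‴ , len = shrink n G free″
        n′< = s≤s (≤-trans n′≤ (*-monoˡ-≤ w (upper G free″)))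
        found = λ l → ∃[ H ] SunflowerFree w k {l} H × length H ≡ length G
    in fromℕ< n′< , subst found (sym (toℕ-fromℕ< n′<)) (G′ , free‴ , len)

-- A local criterion for sunflower-freeness and the cyclic family.

-- The union of the sets A \ S over the members A ⊇ S of a family has to hold
-- the k disjoint sets A i \ S of a sunflower with core S.
module _ {n : ℕ} where

  Near : List (Subset n) → Fin n → Fin n → Set
  Near F x y = x ≢ y × Any (λ A → x ∈ˢ A × y ∈ˢ A) F

  near? : ∀ F → Decidable₂ (Near F)
  near? F x y = ¬? (x ≟ᶠ y) ×-dec anyᴸ? (λ A → (x ∈? A) ×-dec (y ∈? A)) F

  both∈? : ∀ (x y : Fin n) → Decidable (λ A → x ∈ˢ A × y ∈ˢ A)
  both∈? x y A = (x ∈? A) ×-dec (y ∈? A)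

  -- Only points and pairs of points are inspected, so this can be evaluated on the concrete family,
  -- unlike a search through all 7-tuples of subsets.
  Sparse : ℕ → List (Subset n) → Set
  Sparse k F = (∀ x → ∑[ y ∈ allFin n ] 𝟙 (near? F x y) < k * 2)
             × (∀ x y → x ≢ y → length (filter (both∈? x y) F) < k)

  sparse? : ∀ k → Decidable (Sparse k)
  sparse? k F = all? (λ x → ∑[ y ∈ allFin n ] 𝟙 (near? F x y) <? k * 2)
    ×-dec all? (λ x → all? λ y → ¬? (x ≟ᶠ y) →-dec (length (filter (both∈? x y) F) <? k))

  module _ {k : ℕ} {F : List (Subset n)} (uniform : All (λ A → ∣ A ∣ ≡ 3) F)
           (A : Fin (2 + k) → Subset n) (S : IsSunflower A) (A∈ : ∀ i → A i ∈ F) where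

    open IsSunflower S
    private K = allFin (2 + k)

    size-A : ∀ i → ∣ A i ∣ ≡ 3
    size-A i = All.lookup uniform (A∈ i)

    -- The core lies in a petal only by way of its meeting with another petal, hence the number of
    -- petals has the form 2 + k.
    core⊆A : ∀ i {x} → x ∈ˢ core → x ∈ˢ A i
    core⊆A i {x} x∈ with i ≟ᶠ zero
    ... | yes refl = proj₁ (x∈p∩q⁻ (A zero) (A (suc zero)) (subst (x ∈ˢ_) (sym (meet (λ ()))) x∈))
    ... | no i≢0   = proj₁ (x∈p∩q⁻ (A i) (A zero) (subst (x ∈ˢ_) (sym (meet i≢0)) x∈))

    petal-unique : ∀ {x i j} → ¬ x ∈ˢ core → x ∈ˢ A i → x ∈ˢ A j → i ≡ j
    petal-unique {x} {i} {j} x∉ x∈i x∈j =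
      decidable-stable (i ≟ᶠ j) λ i≢j → x∉ (subst (x ∈ˢ_) (meet i≢j) (x∈p∩q⁺ (x∈i , x∈j)))

    length-K : ∀ c → ∑[ _ ∈ K ] c ≡ (2 + k) * c
    length-K c = trans (∑-const K c) (cong (_* c) (length-tabulate {n = 2 + k} id))

    core-empty : (∀ {x} → ¬ x ∈ˢ core) → (2 + k) * 3 ≤ n
    core-empty empty = begin
      (2 + k) * 3
        ≡⟨ sym (length-K 3) ⟩
      ∑[ i ∈ K ] 3
        ≡⟨ ∑-cong K (λ i → trans (sym (size-A i)) (∣∣≡∑ (A i))) ⟩
      ∑[ i ∈ K ] ∑[ x ∈ allFin n ] 𝟙 (x ∈? A i)
        ≡⟨ ∑-swap K (allFin n) _ ⟩
      ∑[ x ∈ allFin n ] ∑[ i ∈ K ] 𝟙 (x ∈? A i)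
        ≤⟨ ∑-mono (allFin n) (λ {x} _ → ∑-𝟙≤1 (λ i → x ∈? A i) (allFin⁺ (2 + k)) (λ _ _ → petal-unique empty)) ⟩
      ∑[ x ∈ allFin n ] 1
        ≡⟨ trans (∑-const (allFin n) 1) (trans (*-identityʳ _) (length-tabulate id)) ⟩
      n ∎
      where open ≤-Reasoning

    core-singleton : ∀ {x} → x ∈ˢ core → (∀ {y} → y ∈ˢ core → x ≡ y) →
                     (2 + k) * 2 ≤ ∑[ y ∈ allFin n ] 𝟙 (near? F x y)
    core-singleton {x} x∈ single = begin
      (2 + k) * 2
        ≡⟨ sym (length-K 2) ⟩
      ∑[ i ∈ K ] 2
        ≤⟨ ∑-mono K (λ {i} _ → two i) ⟩
      ∑[ i ∈ K ] ∑[ y ∈ allFin n ] 𝟙 (other? y i)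
        ≡⟨ ∑-swap K (allFin n) _ ⟩
      ∑[ y ∈ allFin n ] ∑[ i ∈ K ] 𝟙 (other? y i)
        ≤⟨ ∑-mono (allFin n) (λ {y} _ → ∑-𝟙-unique (other? y) (near? F x y) (allFin⁺ (2 + k))
             (λ {i} _ (x≢y , y∈) → x≢y , lose (A∈ i) (core⊆A i x∈ , y∈))
             (λ _ _ (x≢y , y∈i) (_ , y∈j) → petal-unique (x≢y ∘ single) y∈i y∈j)) ⟩
      ∑[ y ∈ allFin n ] 𝟙 (near? F x y) ∎
      where
      open ≤-Reasoning
      other? : ∀ y → Decidable (λ i → x ≢ y × y ∈ˢ A i)
      other? y i = ¬? (x ≟ᶠ y) ×-dec (y ∈? A i)
      two : ∀ i → 2 ≤ ∑[ y ∈ allFin n ] 𝟙 (other? y i)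
      two i with two-others {A = A i} (size-A i) (core⊆A i x∈)
      ... | p , q , (x≢p , x≢q , p≢q) , p∈ , q∈ =
        count-≥ _≟ᶠ_ (λ y → other? y i) {ys = p ∷ q ∷ []} ((p≢q ∷ []) ∷ [] ∷ [])
          λ { (here refl) → ∈-allFin p , x≢p , p∈ ; (there (here refl)) → ∈-allFin q , x≢q , q∈ }

    core-pair : ∀ {x y} → x ∈ˢ core → y ∈ˢ core → 2 + k ≤ length (filter (both∈? x y) F)
    core-pair {x} {y} x∈ y∈ = ≤-trans
      (≤-reflexive (sym (trans (length-map A K) (length-tabulate {n = 2 + k} id))))
      (length-⊆ _≟ˢ_ (Unique-map⁺ distinct (allFin⁺ (2 + k)))
        λ B∈ → let i , _ , eq = ∈-map⁻ A B∈ in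
          subst (_∈ filter (both∈? x y) F) (sym eq)
            (∈-filter⁺ (both∈? x y) (A∈ i) (core⊆A i x∈ , core⊆A i y∈)))

  -- The cases are a core with no point, one point, or at least two; the last needs only two of the
  -- core points, whatever its size.
  sparse⇒sunflower-free : ∀ {k} {F : List (Subset n)} → Unique F → All (λ A → ∣ A ∣ ≡ 3) F →
    n < (2 + k) * 3 → Sparse (2 + k) F → SunflowerFree 3 (2 + k) F
  sparse⇒sunflower-free {k} {F} uniq uniform n< (near< , both<) = record
    { unique = uniq ; uniform = uniform
    ; noSunflower = λ (A , S , A∈) → let open IsSunflower S in
        go A S A∈ (elements core) ∈-elements (λ x∈ → proj₂ (∈-filter⁻ (_∈? core) {xs = allFin n} x∈))
          (filter⁺ (_∈? core) (allFin⁺ n)) }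
    where
    go : ∀ A (S : IsSunflower A) → (∀ i → A i ∈ F) → let open IsSunflower S in
         ∀ xs → (∀ {x} → x ∈ˢ core → x ∈ xs) → (∀ {x} → x ∈ xs → x ∈ˢ core) → Unique xs → ⊥
    go A S A∈ [] ⊆xs xs⊆ _ = <⇒≱ n< (core-empty uniform A S A∈ (λ x∈ → case ⊆xs x∈ of λ ()))
    go A S A∈ (x ∷ []) ⊆xs xs⊆ _ = <⇒≱ (near< x)
      (core-singleton uniform A S A∈ (xs⊆ (here refl)) λ y∈ → case ⊆xs y∈ of λ { (here y≡x) → sym y≡x })
    go A S A∈ (x ∷ y ∷ _) ⊆xs xs⊆ ((x≢y ∷ _) ∷ _) = <⇒≱ (both< x y x≢y)
      (core-pair uniform A S A∈ (xs⊆ (here refl)) (xs⊆ (there (here refl))))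

-- Translates of thirteen base triples in ℤ/20.  All their differences lie in
-- {±1, …, ±6, 10}, and each of these thirteen differences occurs six times.
cyclicFamily : List (Subset 20)
cyclicFamily = cartesianProductWith translate
  ( (1 , 2) ∷ (1 , 3) ∷ (1 , 4) ∷ (1 , 5) ∷ (1 , 6) ∷ (2 , 5) ∷ (2 , 6) ∷ (2 , 16) ∷ (2 , 17)
  ∷ (3 , 6) ∷ (4 , 10) ∷ (4 , 14) ∷ (5 , 10) ∷ []) (upTo 20)
  where
  translate : ℕ × ℕ → ℕ → Subset 20
  translate (b , c) r = ⁅ r mod 20 ⁆ ∪ ⁅ (r + b) mod 20 ⁆ ∪ ⁅ (r + c) mod 20 ⁆

cyclicFamily-unique : Unique cyclicFamily
cyclicFamily-unique = toWitness {a? = unique? _≟ˢ_ cyclicFamily} tt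

cyclicFamily-uniform : All (λ A → ∣ A ∣ ≡ 3) cyclicFamily
cyclicFamily-uniform = toWitness {a? = All.all? (λ A → ∣ A ∣ ≟ 3) cyclicFamily} tt

cyclicFamily-sparse : Sparse 7 cyclicFamily
cyclicFamily-sparse = toWitness {a? = sparse? 7 cyclicFamily} tt

cyclicFamily-free : SunflowerFree 3 7 cyclicFamily
-- `≤-refl` is 20 < 21: seven disjoint triples do not fit on 20 points.
cyclicFamily-free = sparse⇒sunflower-free cyclicFamily-unique cyclicFamily-uniform ≤-refl cyclicFamily-sparse

theorem7p5 : ∃[ m ] Isf 3 7 m × 259 ≤ m × m ≤ 474
-- The family has 13 · 20 = 260 members, one more than the stated lower bound.
theorem7p5 = maximum-exists 474 (λ F → upper-bound) cyclicFamily-free (n≤1+n 259)
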